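{- For all integers $n \geq 0$ and all real $x$ and $y$, \begin{align*} B_n(x) & = \sum_{m=0}^n \sum_{l=0}^m (-1)^m m! \genfrac{\{}{\}}{0pt}{}{n}{m}_x\genfrac{\{}{\}}{0pt}{}{m}{l}_y c_{l}(y), \\ B_n(x) & = \sum_{m=0}^n \sum_{l=0}^m m! \genfrac{\{}{\}}{0pt}{}{n}{m}_x\genfrac{\{}{\}}{0pt}{}{m}{l}_y \widehat{c}_{l}(-y), \\ c_n(x) & = \sum_{m=0}^n \sum_{l=0}^m \frac{(-1)^{n-m+l}}{m!} \genfrac{[}{]}{0pt}{}{n}{m}_x\genfrac{[}{]}{0pt}{}{m}{l}_y B_{l}(y), \\ \widehat{c}_n(-x) & = \sum_{m=0}^n \sum_{l=0}^m \frac{(-1)^{n-l}}{m!} \genfrac{[}{]}{0pt}{}{n}{m}_x\genfrac{[}{]}{0pt}{}{m}{l}_y B_{l}(y). \end{align*}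
   Context: For real $z$ and integer $n\ge 0$, $\binom{z}{n} = \frac{z(z-1)\cdots(z-n+1)}{n!}$. The Cauchy polynomials of the first and second kind are $c_n(x) = n! \int_{0}^{1} \binom{t - x}{n}\, dt$ and $\widehat{c}_n(x) = n! \int_{0}^{1} \binom{x - t}{n}\, dt$, $n \ge 0$. $B_n(x)$ are the classical Bernoulli polynomials, $\frac{te^{xt}}{e^t-1}=\sum_{n\ge0}B_n(x)\frac{t^n}{n!}$. For $0\le m\le n$ and $x \in\mathbb{R}$, the generalized Stirling numbers of the first and second kind are $\genfrac{[}{]}{0pt}{}{n}{m}_x = \sum_{i=0}^{n-m} \binom{i+m}{m}\genfrac{[}{]}{0pt}{}{n}{i+m} x^i$ and $\genfrac{\{}{\}}{0pt}{}{n}{m}_x = \sum_{i=0}^{n-m} \binom{n}{i}\genfrac{\{}{\}}{0pt}{}{n-i}{m} x^i$, where $\genfrac{[}{]}{0pt}{}{n}{m}$ are the unsigned Stirling numbers of the first kind, $\genfrac{\{}{\}}{0pt}{}{n}{m}$ are the Stirling numbers of the second kind, and $x^0=1$. -}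

module Defs where

open import Level using (_⊔_) renaming (suc to lsuc)
open import Algebra.Apartness.Bundles using (HeytingField)
open import Algebra.Bundles using (CommutativeRing; Semiring)
open import Data.Fin.Base using (Fin; zero; suc; toℕ; fromℕ; inject₁)
open import Data.Nat.Base as ℕ using (ℕ; zero; suc; _∸_; _!; NonZero)
open import Data.Nat.Combinatorics using (_C_)
import Data.Nat.Properties as ℕₚ
open import Data.Product.Base using (∃-syntax; _×_; _,_; proj₁; proj₂)
open import Data.Sum.Base using (_⊎_; inj₁; inj₂)
open import Relation.Binary.Core using (Rel)
open import Relation.Binary.Structures using (IsStrictPartialOrder)
open import Relation.Nullary using (¬_)
import Algebra.Apartness.Properties.HeytingCommutativeRing as HeytingProperties
import Algebra.Definitions.RawSemiring as RawSemiringOps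
import Algebra.Properties.Ring as RingProperties

-- The real numbers, as a Cauchy-complete Archimedean ordered field. Classically
-- this determines ℝ up to isomorphism. The order is not assumed decidable, so
-- that the constructive reals are a model too; x ≤ y is ¬ (y < x).
record RealNumbers c ℓ₁ ℓ₂ : Set (lsuc (c ⊔ ℓ₁ ⊔ ℓ₂)) where
  field
    heytingField : HeytingField c ℓ₁ ℓ₂

  open HeytingField heytingField public

  commutativeRing : CommutativeRing c ℓ₁
  commutativeRing = record { isCommutativeRing = isCommutativeRing }

  open CommutativeRing commutativeRing public using (ring; semiring)

  private module Ops = RawSemiringOps (Semiring.rawSemiring semiring)
  open Ops public using (_^_; sum)

  ⟦_⟧ : ℕ → Carrier
  ⟦ n ⟧ = n Ops.× 1#

  infix 4 _<_ _≤_
  field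
    _<_                  : Rel Carrier ℓ₂
    isStrictPartialOrder : IsStrictPartialOrder _≈_ _<_
    <⇒#                  : ∀ {x y} → x < y → x # y
    #⇒<⊎>                : ∀ {x y} → x # y → x < y ⊎ y < x
    +-monoˡ-<            : ∀ z {x y} → x < y → x + z < y + z
    *-positive           : ∀ {x y} → 0# < x → 0# < y → 0# < x * y
    archimedean          : ∀ x → ∃[ n ] x < ⟦ n ⟧

  _≤_ : Rel Carrier ℓ₂
  x ≤ y = ¬ (y < x)

  -- ∣ x - y ∣ < ε
  Within : Carrier → Carrier → Carrier → Set ℓ₂
  Within ε x y = x < y + ε × y < x + ε

  IsCauchySequence : (ℕ → Carrier) → Set (c ⊔ ℓ₂)
  IsCauchySequence u = ∀ ε → 0# < ε →
    ∃[ N ] (∀ m n → N ℕ.≤ m → N ℕ.≤ n → Within ε (u m) (u n))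

  _ConvergesTo_ : (ℕ → Carrier) → Carrier → Set (c ⊔ ℓ₂)
  u ConvergesTo L = ∀ ε → 0# < ε →
    ∃[ N ] (∀ n → N ℕ.≤ n → Within ε (u n) L)

  field
    complete : ∀ u → IsCauchySequence u → ∃[ L ] u ConvergesTo L

stirling₁ : ℕ → ℕ → ℕ
stirling₁ zero    zero    = 1
stirling₁ zero    (suc m) = 0
stirling₁ (suc n) zero    = 0
stirling₁ (suc n) (suc m) = n ℕ.* stirling₁ n (suc m) ℕ.+ stirling₁ n m

stirling₂ : ℕ → ℕ → ℕ
stirling₂ zero    zero    = 1
stirling₂ zero    (suc m) = 0
stirling₂ (suc n) zero    = 0
stirling₂ (suc n) (suc m) = suc m ℕ.* stirling₂ n (suc m) ℕ.+ stirling₂ n m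

module RealAnalysis {c ℓ₁ ℓ₂} (ℝ : RealNumbers c ℓ₁ ℓ₂) where
  open RealNumbers ℝ hiding (zero)

  private
    module < = IsStrictPartialOrder isStrictPartialOrder
    open RingProperties ring using (-‿distribˡ-*; -‿distribʳ-*; -‿involutive)

  0<1 : 0# < 1#
  0<1 with #⇒<⊎> (HeytingProperties.1#0
                    (HeytingField.heytingCommutativeRing heytingField))
  ... | inj₂ 0<1 = 0<1
  ... | inj₁ 1<0 = <.<-respʳ-≈ -1*-1≈1 (*-positive 0<-1 0<-1)
    where
    0<-1 : 0# < - 1#
    0<-1 = <.<-respˡ-≈ (-‿inverseʳ 1#)
             (<.<-respʳ-≈ (+-identityˡ (- 1#)) (+-monoˡ-< (- 1#) 1<0))

    -1*-1≈1 : - 1# * - 1# ≈ 1#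
    -1*-1≈1 = trans (sym (-‿distribˡ-* 1# (- 1#)))
                (trans (-‿cong (*-identityˡ (- 1#))) (-‿involutive 1#))

  0<⟦suc⟧ : ∀ n → 0# < ⟦ suc n ⟧
  0<⟦suc⟧ zero    = <.<-respʳ-≈ (sym (+-identityʳ 1#)) 0<1
  0<⟦suc⟧ (suc n) = <.trans (0<⟦suc⟧ n)
    (<.<-respˡ-≈ (+-identityˡ ⟦ suc n ⟧) (+-monoˡ-< ⟦ suc n ⟧ 0<1))

  ⟦⟧#0 : ∀ n .{{_ : NonZero n}} → ⟦ n ⟧ # 0#
  ⟦⟧#0 (suc n) = #-sym (<⇒# (0<⟦suc⟧ n))

  1/_! : ℕ → Carrier
  1/ n ! = proj₁ (#⇒invertible (⟦⟧#0 (n !) {{ℕₚ._!≢0 n}}))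

  sum≤ : ℕ → (ℕ → Carrier) → Carrier
  sum≤ n f = sum {suc n} (λ i → f (toℕ i))

  infixl 6 sum≤
  syntax sum≤ n (λ i → e) = ∑[ i ≤ n ] e

  -- Riemann integral

  record TaggedPartition (a b : Carrier) (n : ℕ) : Set (c ⊔ ℓ₁ ⊔ ℓ₂) where
    field
      point     : Fin (suc n) → Carrier
      tag       : Fin n → Carrier
      first     : point zero ≈ a
      last      : point (fromℕ n) ≈ b
      point≤tag : ∀ i → point (inject₁ i) ≤ tag i
      tag≤point : ∀ i → tag i ≤ point (suc i)

    width : Fin n → Carrier
    width i = point (suc i) - point (inject₁ i)

    riemannSum : (Carrier → Carrier) → Carrier
    riemannSum f = sum (λ i → f (tag i) * width i)

  HasIntegral : (f : Carrier → Carrier) (a b I : Carrier) → Set (c ⊔ ℓ₁ ⊔ ℓ₂)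
  HasIntegral f a b I = ∀ ε → 0# < ε → ∃[ δ ] 0# < δ ×
    (∀ n (P : TaggedPartition a b n) → let open TaggedPartition P in
       (∀ i → width i < δ) → Within ε (riemannSum f) I)

  -- Cauchy polynomials

  fallingFactorial : Carrier → ℕ → Carrier
  fallingFactorial z zero    = 1#
  fallingFactorial z (suc n) = fallingFactorial z n * (z - ⟦ n ⟧)

  binomial : Carrier → ℕ → Carrier
  binomial z n = fallingFactorial z n * 1/ n !

  -- Integrals are a relation between a function and its value, so the families
  -- of polynomials are specified by predicates, which determine them up to _≈_.

  IsCauchyFirstKind : (ℕ → Carrier → Carrier) → Set (c ⊔ ℓ₁ ⊔ ℓ₂)
  IsCauchyFirstKind p = ∀ n x → ∃[ I ]
    HasIntegral (λ t → binomial (t - x) n) 0# 1# I × p n x ≈ ⟦ n ! ⟧ * I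

  IsCauchySecondKind : (ℕ → Carrier → Carrier) → Set (c ⊔ ℓ₁ ⊔ ℓ₂)
  IsCauchySecondKind p = ∀ n x → ∃[ I ]
    HasIntegral (λ t → binomial (x - t) n) 0# 1# I × p n x ≈ ⟦ n ! ⟧ * I

  -- Bernoulli polynomials, by formal power series in t (coefficient sequences)

  PowerSeries : Set c
  PowerSeries = ℕ → Carrier

  infixl 7 _⊛_
  _⊛_ : PowerSeries → PowerSeries → PowerSeries
  (f ⊛ g) n = ∑[ k ≤ n ] f k * g (n ∸ k)

  oneˢ : PowerSeries
  oneˢ zero    = 1#
  oneˢ (suc n) = 0#

  t : PowerSeries
  t zero    = 0#
  t (suc n) = oneˢ n

  -- Σₙ aₙ tⁿ / n!
  egf : (ℕ → Carrier) → PowerSeries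
  egf a n = a n * 1/ n !

  -- exp x is e^(x t)
  exp : Carrier → PowerSeries
  exp x = egf (x ^_)

  -- t e^(x t) / (e^t - 1) = Σₙ Bₙ(x) tⁿ / n!, with the denominator, which is
  -- not invertible as a power series, multiplied out.
  IsBernoulli : (ℕ → Carrier → Carrier) → Set (c ⊔ ℓ₁)
  IsBernoulli B = ∀ x n →
    ((λ k → exp 1# k - oneˢ k) ⊛ egf (λ k → B k x)) n ≈ (t ⊛ exp x) n

  -- Generalized Stirling numbers, for m ≤ n

  genStirling₁ : ℕ → ℕ → Carrier → Carrier
  genStirling₁ n m x =
    ∑[ i ≤ n ∸ m ] ⟦ (i ℕ.+ m) C m ⟧ * ⟦ stirling₁ n (i ℕ.+ m) ⟧ * x ^ i

  genStirling₂ : ℕ → ℕ → Carrier → Carrier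
  genStirling₂ n m x =
    ∑[ i ≤ n ∸ m ] ⟦ n C i ⟧ * ⟦ stirling₂ (n ∸ i) m ⟧ * x ^ i

{-# OPTIONS --safe #-}

-- Let L be the linear functional on polynomials with moments L(tᵏ) = μₖ. Since
-- tⁿ = Σₘ {n,m}ₓ (t−x)ₘ and (−1)ⁿ (t−x)ₙ = Σₗ [n,l]ₓ (−t)ˡ, where (z)ₘ is the
-- falling factorial, the sequences μ and dₘ = L((t−x)ₘ) determine each other
-- through the generalized Stirling numbers. Three functionals matter:
--   μₖ = 1/(k+1),       integration over [0,1], where dₘ = c₁ₘ(x);
--   μₖ = (−1)ᵏ/(k+1),   the same after t ↦ −t,  where dₘ = c₂ₘ(−x);
--   μₖ = Bₖ(x),         where dₘ = (−1)ᵐ m!/(m+1).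
-- The last value holds because Bernoulli's recurrence says L(p(t+1) − p(t)) = p′(x);
-- take p = (t−x)ₘ₊₁, for which p(t+1) − p(t) = (m+1) (t−x)ₘ. Up to the factor
-- (−1)ᵐ m!, the third sequence d is therefore the first sequence μ, so composing
-- the expansions at x and at y gives the four identities.

module Submission where

open import Defs
open import Data.Nat.Base as ℕ using (ℕ; zero; suc; _∸_; _!)
open import Data.Product.Base using (∃-syntax; _×_; _,_; proj₁; proj₂)

open import Algebra.Bundles using (CommutativeRing)
open import Data.Empty using (⊥; ⊥-elim)
open import Data.Fin.Base using (toℕ)
open import Data.Integer.Base as ℤ using (ℤ; +_; -[1+_]; _⊖_)
open import Data.Maybe.Base using (map)
open import Data.Nat.Combinatorics
  using (_C_; k>n⇒nCk≡0; nCk+nC[k+1]≡[n+1]C[k+1]; nCk≡n!/k![n-k]!; k![n∸k]!∣n!)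
open import Data.Nat.Tactic.RingSolver using (solve-∀)
open import Data.Sum.Base using (inj₁; inj₂; [_,_]′)
open import Level using (_⊔_)
open import Relation.Binary.PropositionalEquality.Core as ≡ using (_≡_)
open import Relation.Binary.Structures using (IsStrictPartialOrder)
open import Relation.Nullary.Decidable.Core using (dec⇒maybe)
import Algebra.Properties.CommutativeSemiring.Exp as Exp
import Algebra.Properties.Ring as RingProperties
import Algebra.Properties.Semiring.Mult as Mult
import Algebra.Properties.Semiring.Mult.TCOptimised as Mult′
import Algebra.Properties.Semiring.Sum as Sum
import Algebra.Solver.Ring
import Algebra.Solver.Ring.AlmostCommutativeRing as ACR
import Data.Fin.Properties as Finₚ
import Data.Integer.Properties as ℤₚ
import Data.Nat.DivMod as ℕ
import Data.Nat.Properties as ℕₚ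
import Relation.Binary.Reasoning.Setoid as SetoidReasoning

-- The functionals are never built as maps on polynomials. Only the array L((t-x)ₘ tᵏ) is kept. Its
-- factor tᵏ is carried along because each recurrence multiplies by t, so every induction has to
-- vary `k`. Integration enters through a given value of `HasIntegral`, which is traded at once for
-- the limit of left Riemann sums over equal cells. Such limits are linear and unique, and this
-- identifies `⟦ n ! ⟧ * I` with a falling moment. The moments 1/(k+1) themselves come from integer
-- bounds on power sums, obtained by telescoping. The order is not decidable: signs are obtained
-- from apartness, and equality of limits from its tightness.

-- Ring solving with integer coefficients.

module IntegerCoefficientSolver {r₁ r₂} (R : CommutativeRing r₁ r₂) where
  open CommutativeRing R
  open RingProperties ring
  open Mult′ semiring renaming (_×_ to _·_)
  open SetoidReasoning setoid

  private
    -- Equality of coefficients has to be decidable, which it is for integers but not for the field.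
    -- The optimised multiple makes `con (+ 1)` evaluate to `1#` itself, whereas `⟦ 1 ⟧` is
    -- `1# + 0#`; this is why `con (+ 1) :+ con (+ 0)` occurs below.
    ⟦_⟧ℤ : ℤ → Carrier
    ⟦ + n ⟧ℤ      = n · 1#
    ⟦ -[1+ n ] ⟧ℤ = - (suc n · 1#)

    cancel-1 : ∀ a b → (1# + a) - (1# + b) ≈ a - b
    cancel-1 a b = begin
      (1# + a) - (1# + b)    ≈⟨ +-cong (+-comm 1# a) (sym (-‿+-comm 1# b)) ⟩
      (a + 1#) + (- 1# - b)  ≈⟨ +-assoc a 1# _ ⟩
      a + (1# + (- 1# - b))  ≈⟨ +-congˡ (+-assoc 1# (- 1#) (- b)) ⟨
      a + ((1# - 1#) - b)    ≈⟨ +-congˡ (+-congʳ (-‿inverseʳ 1#)) ⟩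
      a + (0# - b)           ≈⟨ +-congˡ (+-identityˡ (- b)) ⟩
      a - b                  ∎

    ⊖-homo : ∀ m n → ⟦ m ⊖ n ⟧ℤ ≈ m · 1# - n · 1#
    ⊖-homo m       zero    = sym (trans (+-congˡ -0#≈0#) (+-identityʳ _))
    ⊖-homo zero    (suc n) = sym (+-identityˡ _)
    ⊖-homo (suc m) (suc n) = begin
      ⟦ suc m ⊖ suc n ⟧ℤ               ≡⟨ ≡.cong ⟦_⟧ℤ (ℤₚ.[1+m]⊖[1+n]≡m⊖n m n) ⟩
      ⟦ m ⊖ n ⟧ℤ                       ≈⟨ ⊖-homo m n ⟩
      m · 1# - n · 1#                  ≈⟨ cancel-1 _ _ ⟨
      (1# + m · 1#) - (1# + n · 1#)    ≈⟨ +-cong (1+× m 1#) (-‿cong (1+× n 1#)) ⟨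
      suc m · 1# - suc n · 1#          ∎

    +-homo : ∀ i j → ⟦ i ℤ.+ j ⟧ℤ ≈ ⟦ i ⟧ℤ + ⟦ j ⟧ℤ
    +-homo (+ m)      (+ n)      = ×-homo-+ 1# m n
    +-homo (+ m)      -[1+ n ]   = ⊖-homo m (suc n)
    +-homo -[1+ m ]   (+ n)      = trans (⊖-homo n (suc m)) (+-comm _ _)
    +-homo -[1+ m ]   -[1+ n ]   = begin
      - (suc (suc (m ℕ.+ n)) · 1#)  ≡⟨ ≡.cong (λ k → - (suc k · 1#)) (ℕₚ.+-suc m n) ⟨
      - ((suc m ℕ.+ suc n) · 1#)    ≈⟨ -‿cong (×-homo-+ 1# (suc m) (suc n)) ⟩
      - (suc m · 1# + suc n · 1#)   ≈⟨ -‿+-comm _ _ ⟨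
      - (suc m · 1#) - suc n · 1#   ∎

    -‿homo : ∀ i → ⟦ ℤ.- i ⟧ℤ ≈ - ⟦ i ⟧ℤ
    -‿homo (+ zero)  = sym -0#≈0#
    -‿homo (+ suc n) = refl
    -‿homo -[1+ n ]  = sym (-‿involutive _)

    +*-homo : ∀ m j → ⟦ + m ℤ.* j ⟧ℤ ≈ m · 1# * ⟦ j ⟧ℤ
    +*-homo m (+ n)    = trans (reflexive (≡.cong ⟦_⟧ℤ (≡.sym (ℤₚ.pos-* m n)))) (×1-homo-* m n)
    +*-homo m -[1+ n ] = begin
      ⟦ + m ℤ.* -[1+ n ] ⟧ℤ         ≡⟨ ≡.cong ⟦_⟧ℤ (ℤₚ.neg-distribʳ-* (+ m) (+ suc n)) ⟨
      ⟦ ℤ.- (+ m ℤ.* + suc n) ⟧ℤ    ≈⟨ -‿homo (+ m ℤ.* + suc n) ⟩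
      - ⟦ + m ℤ.* + suc n ⟧ℤ        ≈⟨ -‿cong (+*-homo m (+ suc n)) ⟩
      - (m · 1# * (suc n · 1#))     ≈⟨ -‿distribʳ-* _ _ ⟩
      m · 1# * - (suc n · 1#)       ∎

    *-homo : ∀ i j → ⟦ i ℤ.* j ⟧ℤ ≈ ⟦ i ⟧ℤ * ⟦ j ⟧ℤ
    *-homo (+ m)    j = +*-homo m j
    *-homo -[1+ m ] j = begin
      ⟦ -[1+ m ] ℤ.* j ⟧ℤ        ≡⟨ ≡.cong ⟦_⟧ℤ (ℤₚ.neg-distribˡ-* (+ suc m) j) ⟨
      ⟦ ℤ.- (+ suc m ℤ.* j) ⟧ℤ   ≈⟨ -‿homo (+ suc m ℤ.* j) ⟩
      - ⟦ + suc m ℤ.* j ⟧ℤ       ≈⟨ -‿cong (+*-homo (suc m) j) ⟩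
      - (suc m · 1# * ⟦ j ⟧ℤ)    ≈⟨ -‿distribˡ-* _ _ ⟩
      - (suc m · 1#) * ⟦ j ⟧ℤ    ∎

    morphism : CommutativeRing.rawRing ℤₚ.+-*-commutativeRing
                 ACR.-Raw-AlmostCommutative⟶ ACR.fromCommutativeRing R
    morphism = record
      { ⟦_⟧    = ⟦_⟧ℤ
      ; +-homo = +-homo
      ; *-homo = *-homo
      ; -‿homo = -‿homo
      ; 0-homo = refl
      ; 1-homo = refl
      }

  open Algebra.Solver.Ring _ _ morphism
    (λ i j → map (λ i≡j → reflexive (≡.cong ⟦_⟧ℤ i≡j)) (dec⇒maybe (i ℤₚ.≟ j)))
    public
    using (solve; _:=_; _:+_; _:*_; _:-_; :-_; con)

module Umbral {c ℓ₁ ℓ₂} (ℝ : RealNumbers c ℓ₁ ℓ₂) where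
  open RealNumbers ℝ hiding (zero)
  open RealAnalysis ℝ
  open IntegerCoefficientSolver commutativeRing
  open SetoidReasoning (CommutativeRing.setoid commutativeRing)

  -- Finite sums and the image of the naturals in the field.

  sum≤-cong-≤ : ∀ n {f g : ℕ → Carrier} → (∀ i → i ℕ.≤ n → f i ≈ g i) → sum≤ n f ≈ sum≤ n g
  sum≤-cong-≤ zero    f≈g = +-congʳ (f≈g 0 ℕ.z≤n)
  sum≤-cong-≤ (suc n) f≈g = +-cong (f≈g 0 ℕ.z≤n) (sum≤-cong-≤ n (λ i i≤n → f≈g (suc i) (ℕ.s≤s i≤n)))

  sum≤-cong : ∀ n {f g : ℕ → Carrier} → (∀ i → f i ≈ g i) → sum≤ n f ≈ sum≤ n g
  sum≤-cong n f≈g = sum≤-cong-≤ n (λ i _ → f≈g i)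

  sum≤-last : ∀ n (f : ℕ → Carrier) → sum≤ (suc n) f ≈ sum≤ n f + f (suc n)
  sum≤-last zero    f = trans (sym (+-assoc _ _ _)) (trans (+-identityʳ _) (+-congʳ (sym (+-identityʳ _))))
  sum≤-last (suc n) f = trans (+-congˡ (sum≤-last n (λ i → f (suc i)))) (sym (+-assoc _ _ _))

  sum≤-+ : ∀ n (f g : ℕ → Carrier) → sum≤ n (λ i → f i + g i) ≈ sum≤ n f + sum≤ n g
  sum≤-+ n f g = Sum.∑-distrib-+ semiring {suc n} (λ i → f (toℕ i)) (λ i → g (toℕ i))

  *-distribˡ-sum≤ : ∀ n a (f : ℕ → Carrier) → a * sum≤ n f ≈ sum≤ n (λ i → a * f i)
  *-distribˡ-sum≤ n a f = Sum.*-distribˡ-sum semiring {suc n} a (λ i → f (toℕ i))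

  sum≤-linear : ∀ n r s (f g : ℕ → Carrier) →
    sum≤ n (λ i → r * f i + s * g i) ≈ r * sum≤ n f + s * sum≤ n g
  sum≤-linear n r s f g = trans (sum≤-+ n (λ i → r * f i) (λ i → s * g i))
    (sym (+-cong (*-distribˡ-sum≤ n r f) (*-distribˡ-sum≤ n s g)))

  sum≤-zero : ∀ n {f : ℕ → Carrier} → (∀ i → i ℕ.≤ n → f i ≈ 0#) → sum≤ n f ≈ 0#
  sum≤-zero zero    f≈0 = trans (+-identityʳ _) (f≈0 0 ℕ.z≤n)
  sum≤-zero (suc n) f≈0 =
    trans (+-cong (f≈0 0 ℕ.z≤n) (sum≤-zero n (λ i i≤n → f≈0 (suc i) (ℕ.s≤s i≤n)))) (+-identityˡ 0#)

  sum≤-truncate : ∀ {k n} {f : ℕ → Carrier} → k ℕ.≤ n →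
    (∀ i → k ℕ.< i → i ℕ.≤ n → f i ≈ 0#) → sum≤ n f ≈ sum≤ k f
  sum≤-truncate {zero}  {zero}  k≤n         f≈0 = refl
  sum≤-truncate {zero}  {suc n} k≤n         f≈0 =
    +-congˡ (sum≤-zero n (λ i i≤n → f≈0 (suc i) (ℕ.s≤s ℕ.z≤n) (ℕ.s≤s i≤n)))
  sum≤-truncate {suc k} {suc n} (ℕ.s≤s k≤n) f≈0 =
    +-congˡ (sum≤-truncate k≤n (λ i k<i i≤n → f≈0 (suc i) (ℕ.s≤s k<i) (ℕ.s≤s i≤n)))

  ⟦⟧-cong : ∀ {m n} → m ≡ n → ⟦ m ⟧ ≈ ⟦ n ⟧
  ⟦⟧-cong m≡n = reflexive (≡.cong ⟦_⟧ m≡n)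

  ⟦⟧-homo-+ : ∀ m n → ⟦ m ℕ.+ n ⟧ ≈ ⟦ m ⟧ + ⟦ n ⟧
  ⟦⟧-homo-+ = Mult.×-homo-+ semiring 1#

  ⟦⟧-homo-* : ∀ m n → ⟦ m ℕ.* n ⟧ ≈ ⟦ m ⟧ * ⟦ n ⟧
  ⟦⟧-homo-* = Mult.×1-homo-* semiring

  ⟦⟧-homo-^ : ∀ m n → ⟦ m ℕ.^ n ⟧ ≈ ⟦ m ⟧ ^ n
  ⟦⟧-homo-^ m zero    = +-identityʳ 1#
  ⟦⟧-homo-^ m (suc n) = trans (⟦⟧-homo-* m (m ℕ.^ n)) (*-congˡ (⟦⟧-homo-^ m n))

  -- Binomial convolution.

  -- The n-th derivative of a product whose factors have derivatives `a` and `b`; equivalently, the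
  -- product of their exponential generating functions.
  leibniz : ℕ → (a b : ℕ → Carrier) → Carrier
  leibniz n a b = ∑[ i ≤ n ] ⟦ n C i ⟧ * a (n ∸ i) * b i

  leibniz-cong : ∀ n {a a′ b b′ : ℕ → Carrier} → (∀ i → a i ≈ a′ i) → (∀ i → b i ≈ b′ i) →
                 leibniz n a b ≈ leibniz n a′ b′
  leibniz-cong n a≈a′ b≈b′ = sum≤-cong n (λ i → *-cong (*-congˡ {⟦ n C i ⟧} (a≈a′ (n ∸ i))) (b≈b′ i))

  leibniz-linearˡ : ∀ n r s (a a′ b : ℕ → Carrier) →
    leibniz n (λ i → r * a i + s * a′ i) b ≈ r * leibniz n a b + s * leibniz n a′ b
  leibniz-linearˡ n r s a a′ b = begin
    leibniz n (λ i → r * a i + s * a′ i) b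
      ≈⟨ sum≤-cong n (λ i → solve 6 (λ r s C a a′ b →
           C :* (r :* a :+ s :* a′) :* b := r :* (C :* a :* b) :+ s :* (C :* a′ :* b))
           refl r s ⟦ n C i ⟧ (a (n ∸ i)) (a′ (n ∸ i)) (b i)) ⟩
    sum≤ n (λ i → r * (⟦ n C i ⟧ * a (n ∸ i) * b i) + s * (⟦ n C i ⟧ * a′ (n ∸ i) * b i))
      ≈⟨ sum≤-linear n r s (λ i → ⟦ n C i ⟧ * a (n ∸ i) * b i) (λ i → ⟦ n C i ⟧ * a′ (n ∸ i) * b i) ⟩
    r * leibniz n a b + s * leibniz n a′ b ∎

  leibniz-scaleʳ : ∀ n s (a b : ℕ → Carrier) → leibniz n a (λ i → s * b i) ≈ s * leibniz n a b
  leibniz-scaleʳ n s a b = begin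
    leibniz n a (λ i → s * b i)
      ≈⟨ sum≤-cong n (λ i → solve 4 (λ s C a b → C :* a :* (s :* b) := s :* (C :* a :* b))
           refl s ⟦ n C i ⟧ (a (n ∸ i)) (b i)) ⟩
    sum≤ n (λ i → s * (⟦ n C i ⟧ * a (n ∸ i) * b i))
      ≈⟨ *-distribˡ-sum≤ n s (λ i → ⟦ n C i ⟧ * a (n ∸ i) * b i) ⟨
    s * leibniz n a b ∎

  -- Differentiating the product once more. Pascal's rule separates the derivative of the second
  -- factor from that of the first.
  leibniz-suc : ∀ n (a b : ℕ → Carrier) →
    leibniz (suc n) a b ≈ leibniz n (λ i → a (suc i)) b + leibniz n a (λ i → b (suc i))
  leibniz-suc n a b = begin
    first + sum≤ n (λ i → ⟦ suc n C suc i ⟧ * a (n ∸ i) * b (suc i))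
      ≈⟨ +-congˡ (sum≤-cong n pascal) ⟩
    first + sum≤ n (λ i → upper i + lower i)
      ≈⟨ +-congˡ (sum≤-+ n upper lower) ⟩
    first + (leibniz n a (λ i → b (suc i)) + sum≤ n lower)
      ≈⟨ solve 3 (λ f u l → f :+ (u :+ l) := (f :+ l) :+ u) refl first _ (sum≤ n lower) ⟩
    sum≤ (suc n) (λ i → ⟦ n C i ⟧ * a (suc n ∸ i) * b i) + leibniz n a (λ i → b (suc i))
      -- The extra term `i = suc n` carries the coefficient `n C suc n`, which is 0.
      ≈⟨ +-congʳ (sum≤-truncate (ℕₚ.n≤1+n n) (λ i n<i _ →
           trans (*-congʳ {b i} (trans (*-congʳ {a (suc n ∸ i)} (⟦⟧-cong (k>n⇒nCk≡0 n<i))) (zeroˡ _)))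
                 (zeroˡ _))) ⟩
    sum≤ n (λ i → ⟦ n C i ⟧ * a (suc n ∸ i) * b i) + leibniz n a (λ i → b (suc i))
      -- Truncated subtraction gives `suc n ∸ i ≡ suc (n ∸ i)` only for `i ≤ n`, hence the bounded
      -- congruence.
      ≈⟨ +-congʳ (sum≤-cong-≤ n (λ i i≤n →
           *-congʳ {b i} (*-congˡ {⟦ n C i ⟧} (reflexive (≡.cong a (ℕₚ.+-∸-assoc 1 i≤n)))))) ⟩
    leibniz n (λ i → a (suc i)) b + leibniz n a (λ i → b (suc i)) ∎
    where
    first = ⟦ suc n C 0 ⟧ * a (suc n) * b 0

    upper lower : ℕ → Carrier
    upper i = ⟦ n C i ⟧ * a (n ∸ i) * b (suc i)
    lower i = ⟦ n C suc i ⟧ * a (n ∸ i) * b (suc i)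

    pascal : ∀ i → ⟦ suc n C suc i ⟧ * a (n ∸ i) * b (suc i) ≈ upper i + lower i
    pascal i = begin
      ⟦ suc n C suc i ⟧ * a (n ∸ i) * b (suc i)
        ≈⟨ *-congʳ (*-congʳ (trans (⟦⟧-cong (≡.sym (nCk+nC[k+1]≡[n+1]C[k+1] n i)))
             (⟦⟧-homo-+ (n C i) (n C suc i)))) ⟩
      (⟦ n C i ⟧ + ⟦ n C suc i ⟧) * a (n ∸ i) * b (suc i)
        ≈⟨ solve 4 (λ c d a b → (c :+ d) :* a :* b := c :* a :* b :+ d :* a :* b) refl _ _ _ _ ⟩
      upper i + lower i ∎

  -- Triangular arrays with weights.

  -- Both kinds of Stirling numbers obey this recurrence and differ only in the weight: `x + ⟦ m ⟧`
  -- for the second kind, `x + ⟦ n ⟧` for the first. `col₀` is `step` with the entry to the left of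
  -- column 0 read as zero.
  record IsTriangular (w A : ℕ → ℕ → Carrier) : Set ℓ₁ where
    field
      corner : A 0 0 ≈ 1#
      row₀   : ∀ m → A 0 (suc m) ≈ 0#
      col₀   : ∀ n → A (suc n) 0 ≈ w n 0 * A n 0
      step   : ∀ n m → A (suc n) (suc m) ≈ A n m + w n (suc m) * A n (suc m)

    upper-zero : ∀ {n m} → n ℕ.< m → A n m ≈ 0#
    upper-zero {zero}  {suc m} _           = row₀ m
    upper-zero {suc n} {suc m} (ℕ.s≤s n<m) = begin
      A (suc n) (suc m)                ≈⟨ step n m ⟩
      A n m + w n (suc m) * A n (suc m) ≈⟨ +-cong (upper-zero n<m) (*-congˡ (upper-zero (ℕₚ.m≤n⇒m≤1+n n<m))) ⟩
      0# + w n (suc m) * 0#            ≈⟨ trans (+-identityˡ _) (zeroʳ _) ⟩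
      0#                               ∎

    -- Moves the recurrence from `A` onto `G`: passing to the next row of `A` is the same as
    -- applying "shift plus weight" to `G`. Both Stirling expansions are inductions on this.
    sum-row-suc : ∀ n (G : ℕ → Carrier) →
      sum≤ (suc n) (λ m → A (suc n) m * G m) ≈ sum≤ n (λ m → A n m * (G (suc m) + w n m * G m))
    sum-row-suc n G = begin
      A (suc n) 0 * G 0 + sum≤ n (λ m → A (suc n) (suc m) * G (suc m))
        ≈⟨ +-cong (*-congʳ (col₀ n))
             (sum≤-cong n (λ m → trans (*-congʳ {G (suc m)} (step n m)) (distribʳ _ _ _))) ⟩
      weighted 0 + sum≤ n (λ m → shifted m + weighted (suc m))
        ≈⟨ +-congˡ (sum≤-+ n shifted (λ m → weighted (suc m))) ⟩
      weighted 0 + (sum≤ n shifted + sum≤ n (λ m → weighted (suc m)))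
        ≈⟨ solve 3 (λ a b c → a :+ (b :+ c) := b :+ (a :+ c)) refl _ _ _ ⟩
      sum≤ n shifted + sum≤ (suc n) weighted
        -- `weighted (suc n)` contains `A n (suc n)`, an entry above the diagonal.
        ≈⟨ +-congˡ (sum≤-truncate (ℕₚ.n≤1+n n) λ m n<m _ →
             trans (*-congʳ {G m} (trans (*-congˡ {w n m} (upper-zero n<m)) (zeroʳ _))) (zeroˡ _)) ⟩
      sum≤ n shifted + sum≤ n weighted
        ≈⟨ sum≤-+ n shifted weighted ⟨
      sum≤ n (λ m → shifted m + weighted m)
        ≈⟨ sum≤-cong n (λ m → solve 4 (λ a g w h → a :* g :+ w :* a :* h := a :* (g :+ w :* h))
             refl (A n m) (G (suc m)) (w n m) (G m)) ⟩
      sum≤ n (λ m → A n m * (G (suc m) + w n m * G m)) ∎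
      where
      shifted weighted : ℕ → Carrier
      shifted m  = A n m * G (suc m)
      weighted m = w n m * A n m * G m

  -- Recurrences of the generalized Stirling numbers.

  -- Summing to n instead of n − m adds only zero terms when m ≤ n, and makes the
  -- triangular recurrences valid for all m.
  genStirling₂-full genStirling₁-full : Carrier → ℕ → ℕ → Carrier
  genStirling₂-full x n m = leibniz n (λ i → ⟦ stirling₂ i m ⟧) (x ^_)
  genStirling₁-full x n m =
    ∑[ i ≤ n ] ⟦ (i ℕ.+ m) C m ⟧ * ⟦ stirling₁ n (i ℕ.+ m) ⟧ * x ^ i

  stirling₁-zero : ∀ {n m} → n ℕ.< m → stirling₁ n m ≡ 0
  stirling₁-zero {zero}  {suc m} _           = ≡.refl
  stirling₁-zero {suc n} {suc m} (ℕ.s≤s n<m)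
    rewrite stirling₁-zero n<m | stirling₁-zero (ℕₚ.m≤n⇒m≤1+n n<m) =
    ≡.trans (ℕₚ.+-identityʳ (n ℕ.* 0)) (ℕₚ.*-zeroʳ n)

  stirling₂-zero : ∀ {n m} → n ℕ.< m → stirling₂ n m ≡ 0
  stirling₂-zero {zero}  {suc m} _           = ≡.refl
  stirling₂-zero {suc n} {suc m} (ℕ.s≤s n<m)
    rewrite stirling₂-zero n<m | stirling₂-zero (ℕₚ.m≤n⇒m≤1+n n<m) =
    ≡.trans (ℕₚ.+-identityʳ (m ℕ.* 0)) (ℕₚ.*-zeroʳ m)

  middle-zero : ∀ a b {k} → k ≡ 0 → a * ⟦ k ⟧ * b ≈ 0#
  middle-zero a b ≡.refl = trans (*-congʳ (zeroʳ a)) (zeroˡ b)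

  genStirling₁≈full : ∀ x {n m} → m ℕ.≤ n → genStirling₁ n m x ≈ genStirling₁-full x n m
  genStirling₁≈full x {n} {m} m≤n = sym (sum≤-truncate (ℕₚ.m∸n≤m n m) λ i n∸m<i i≤n →
    middle-zero ⟦ (i ℕ.+ m) C m ⟧ (x ^ i)
      (stirling₁-zero (≡.subst (ℕ._< i ℕ.+ m) (ℕₚ.m∸n+n≡m m≤n) (ℕₚ.+-monoˡ-< m n∸m<i))))

  genStirling₂≈full : ∀ x {n m} → m ℕ.≤ n → genStirling₂ n m x ≈ genStirling₂-full x n m
  genStirling₂≈full x {n} {m} m≤n = sym (sum≤-truncate (ℕₚ.m∸n≤m n m) λ i n∸m<i i≤n →
    middle-zero ⟦ n C i ⟧ (x ^ i)
      (stirling₂-zero (≡.subst (n ∸ i ℕ.<_) (ℕₚ.m∸[m∸n]≡n m≤n) (ℕₚ.∸-monoʳ-< n∸m<i i≤n))))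

  -- The generating function of column m is e^(xt) (e^t - 1)^m / m!. Differentiating e^(xt)
  -- contributes the weight `x`, and the ordinary recurrence of the other factor contributes
  -- `⟦ m ⟧`.
  genStirling₂-triangular : ∀ x → IsTriangular (λ n m → x + ⟦ m ⟧) (genStirling₂-full x)
  genStirling₂-triangular x = record
    { corner = solve 0 ((con (+ 1) :+ con (+ 0)) :* (con (+ 1) :+ con (+ 0)) :* con (+ 1) :+ con (+ 0)
                          := con (+ 1)) refl
    ; row₀   = λ m → trans (+-identityʳ _) (middle-zero ⟦ 0 C 0 ⟧ 1# {0} ≡.refl)
    ; col₀   = λ n → begin
        genStirling₂-full x (suc n) 0
          ≈⟨ leibniz-suc n (λ i → ⟦ stirling₂ i 0 ⟧) (x ^_) ⟩
        leibniz n (λ i → 0#) (x ^_) + leibniz n (λ i → ⟦ stirling₂ i 0 ⟧) (λ i → x * x ^ i)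
          ≈⟨ +-cong (sum≤-zero n (λ i _ → middle-zero ⟦ n C i ⟧ (x ^ i) {0} ≡.refl))
                    (leibniz-scaleʳ n x (λ i → ⟦ stirling₂ i 0 ⟧) (x ^_)) ⟩
        0# + x * genStirling₂-full x n 0
          ≈⟨ solve 2 (λ x a → con (+ 0) :+ x :* a := (x :+ con (+ 0)) :* a) refl x _ ⟩
        (x + ⟦ 0 ⟧) * genStirling₂-full x n 0 ∎
    ; step   = λ n m → let S = λ m i → ⟦ stirling₂ i m ⟧ in begin
        genStirling₂-full x (suc n) (suc m)
          ≈⟨ leibniz-suc n (S (suc m)) (x ^_) ⟩
        leibniz n (λ i → S (suc m) (suc i)) (x ^_) + leibniz n (S (suc m)) (λ i → x * x ^ i)
          ≈⟨ +-cong (leibniz-cong n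
                      (λ i → trans (⟦⟧-homo-+ (suc m ℕ.* stirling₂ i (suc m)) (stirling₂ i m))
                        (+-cong (⟦⟧-homo-* (suc m) (stirling₂ i (suc m))) (sym (*-identityˡ _))))
                      (λ i → refl {x ^ i}))
                    (leibniz-scaleʳ n x (S (suc m)) (x ^_)) ⟩
        leibniz n (λ i → ⟦ suc m ⟧ * S (suc m) i + 1# * S m i) (x ^_) + x * genStirling₂-full x n (suc m)
          ≈⟨ +-congʳ (leibniz-linearˡ n ⟦ suc m ⟧ 1# (S (suc m)) (S m) (x ^_)) ⟩
        (⟦ suc m ⟧ * genStirling₂-full x n (suc m) + 1# * genStirling₂-full x n m)
          + x * genStirling₂-full x n (suc m)
          ≈⟨ solve 4 (λ k x a b → (k :* a :+ con (+ 1) :* b) :+ x :* a := b :+ (x :+ k) :* a) refl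
               ⟦ suc m ⟧ x (genStirling₂-full x n (suc m)) (genStirling₂-full x n m) ⟩
        genStirling₂-full x n m + (x + ⟦ suc m ⟧) * genStirling₂-full x n (suc m) ∎
    }

  -- Row n lists the coefficients of (t+x)(t+x+1)...(t+x+n-1), obtained by expanding the powers of
  -- t+x. The next row is a multiplication by t + (x+n).
  genStirling₁-triangular : ∀ x → IsTriangular (λ n m → x + ⟦ n ⟧) (genStirling₁-full x)
  genStirling₁-triangular x = record
    { corner = solve 0 ((con (+ 1) :+ con (+ 0)) :* (con (+ 1) :+ con (+ 0)) :* con (+ 1) :+ con (+ 0)
                          := con (+ 1)) refl
    ; row₀   = λ m → trans (+-identityʳ _) (middle-zero ⟦ suc m C suc m ⟧ 1# {0} ≡.refl)
    ; col₀   = col₀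
    ; step   = step
    }
    where
    term : ℕ → ℕ → ℕ → Carrier
    term n m i = ⟦ (i ℕ.+ m) C m ⟧ * ⟦ stirling₁ n (i ℕ.+ m) ⟧ * x ^ i

    term-last : ∀ n m → sum≤ (suc n) (term n m) ≈ genStirling₁-full x n m
    term-last n m = sum≤-truncate (ℕₚ.n≤1+n n) λ i n<i _ →
      middle-zero ⟦ (i ℕ.+ m) C m ⟧ (x ^ i) (stirling₁-zero (ℕₚ.≤-trans n<i (ℕₚ.m≤m+n i m)))

    -- For `n = 0` the factor `⟦ n ⟧` vanishes although `term 0 0 0` does not; otherwise
    -- `stirling₁ n 0` is 0. This lets the vanishing constant term be replaced by the `i = 0`
    -- summand that the sum on the right lacks.
    n*term₀≈0 : ∀ n → ⟦ n ⟧ * term n 0 0 ≈ 0#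
    n*term₀≈0 zero    = zeroˡ _
    n*term₀≈0 (suc n) = trans (*-congˡ (middle-zero ⟦ 1 ⟧ 1# {0} ≡.refl)) (zeroʳ _)

    col₀ : ∀ n → genStirling₁-full x (suc n) 0 ≈ (x + ⟦ n ⟧) * genStirling₁-full x n 0
    col₀ n = begin
      genStirling₁-full x (suc n) 0
        ≈⟨ trans (+-congʳ (trans (middle-zero ⟦ 1 ⟧ 1# {0} ≡.refl) (sym (n*term₀≈0 n))))
                 (+-congˡ (sum≤-cong n split)) ⟩
      ⟦ n ⟧ * term n 0 0 + sum≤ n (λ i → ⟦ n ⟧ * term n 0 (suc i) + x * term n 0 i)
        ≈⟨ trans (+-congˡ (sum≤-+ n (λ i → ⟦ n ⟧ * term n 0 (suc i)) (λ i → x * term n 0 i)))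
                 (sym (+-assoc _ _ _)) ⟩
      sum≤ (suc n) (λ i → ⟦ n ⟧ * term n 0 i) + sum≤ n (λ i → x * term n 0 i)
        ≈⟨ +-cong (trans (*-congˡ (sym (term-last n 0))) (*-distribˡ-sum≤ (suc n) ⟦ n ⟧ (term n 0)))
                  (*-distribˡ-sum≤ n x (term n 0)) ⟨
      ⟦ n ⟧ * genStirling₁-full x n 0 + x * genStirling₁-full x n 0
        ≈⟨ solve 3 (λ k x a → k :* a :+ x :* a := (x :+ k) :* a) refl ⟦ n ⟧ x _ ⟩
      (x + ⟦ n ⟧) * genStirling₁-full x n 0 ∎
      where
      split : ∀ i → term (suc n) 0 (suc i) ≈ ⟦ n ⟧ * term n 0 (suc i) + x * term n 0 i
      split i = trans
        (*-congʳ (*-congˡ (trans (⟦⟧-homo-+ (n ℕ.* stirling₁ n (suc (i ℕ.+ 0))) _)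
          (+-congʳ (⟦⟧-homo-* n _)))))
        (solve 6 (λ c k s s′ x y → c :* (k :* s :+ s′) :* (x :* y) :=
                                   k :* (c :* s :* (x :* y)) :+ x :* (c :* s′ :* y))
          refl ⟦ 1 ⟧ ⟦ n ⟧ ⟦ stirling₁ n (suc (i ℕ.+ 0)) ⟧ ⟦ stirling₁ n (i ℕ.+ 0) ⟧ x (x ^ i))

    step : ∀ n m → genStirling₁-full x (suc n) (suc m) ≈
      genStirling₁-full x n m + (x + ⟦ n ⟧) * genStirling₁-full x n (suc m)
    step n m = begin
      genStirling₁-full x (suc n) (suc m)
        ≈⟨ sum≤-cong (suc n) split ⟩
      sum≤ (suc n) (λ i → (⟦ n ⟧ * term n (suc m) i + term n m i) + raised i)
        ≈⟨ trans (sum≤-+ (suc n) (λ i → ⟦ n ⟧ * term n (suc m) i + term n m i) raised)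
                 (+-congʳ (sum≤-+ (suc n) (λ i → ⟦ n ⟧ * term n (suc m) i) (term n m))) ⟩
      (sum≤ (suc n) (λ i → ⟦ n ⟧ * term n (suc m) i) + sum≤ (suc n) (term n m)) + sum≤ (suc n) raised
        ≈⟨ +-cong (+-cong (trans (sym (*-distribˡ-sum≤ (suc n) ⟦ n ⟧ (term n (suc m))))
                                  (*-congˡ (term-last n (suc m))))
                           (term-last n m))
                  (trans (+-cong raised₀ (trans (sum≤-cong n raised-suc) (sym (*-distribˡ-sum≤ n x (term n (suc m))))))
                         (+-identityˡ _)) ⟩
      (⟦ n ⟧ * genStirling₁-full x n (suc m) + genStirling₁-full x n m) + x * genStirling₁-full x n (suc m)
        ≈⟨ solve 4 (λ k x a b → (k :* a :+ b) :+ x :* a := b :+ (x :+ k) :* a) refl ⟦ n ⟧ x _ _ ⟩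
      genStirling₁-full x n m + (x + ⟦ n ⟧) * genStirling₁-full x n (suc m) ∎
      where
      -- The second half of Pascal's rule. Its term at 0 vanishes, and shifting the index by one
      -- turns the rest into `x` times column `suc m`.
      raised : ℕ → Carrier
      raised i = ⟦ (i ℕ.+ m) C suc m ⟧ * ⟦ stirling₁ n (i ℕ.+ m) ⟧ * x ^ i

      raised₀ : raised 0 ≈ 0#
      raised₀ = trans (*-congʳ (trans (*-congʳ (⟦⟧-cong (k>n⇒nCk≡0 (ℕₚ.n<1+n m)))) (zeroˡ _))) (zeroˡ _)

      raised-suc : ∀ i → raised (suc i) ≈ x * term n (suc m) i
      raised-suc i rewrite ℕₚ.+-suc i m =
        solve 4 (λ c s x y → c :* s :* (x :* y) := x :* (c :* s :* y)) refl
          ⟦ suc (i ℕ.+ m) C suc m ⟧ ⟦ stirling₁ n (suc (i ℕ.+ m)) ⟧ x (x ^ i)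

      split : ∀ i → term (suc n) (suc m) i ≈ (⟦ n ⟧ * term n (suc m) i + term n m i) + raised i
      split i rewrite ℕₚ.+-suc i m = begin
        ⟦ suc (i ℕ.+ m) C suc m ⟧ * ⟦ n ℕ.* s ℕ.+ s′ ⟧ * x ^ i
          ≈⟨ *-congʳ (*-congˡ (trans (⟦⟧-homo-+ (n ℕ.* s) s′) (+-congʳ (⟦⟧-homo-* n s)))) ⟩
        ⟦ suc (i ℕ.+ m) C suc m ⟧ * (⟦ n ⟧ * ⟦ s ⟧ + ⟦ s′ ⟧) * x ^ i
          ≈⟨ solve 5 (λ c k s s′ y → c :* (k :* s :+ s′) :* y := k :* (c :* s :* y) :+ c :* s′ :* y) refl
               ⟦ suc (i ℕ.+ m) C suc m ⟧ ⟦ n ⟧ ⟦ s ⟧ ⟦ s′ ⟧ (x ^ i) ⟩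
        scaled + ⟦ suc (i ℕ.+ m) C suc m ⟧ * ⟦ s′ ⟧ * x ^ i
          ≈⟨ +-congˡ (*-congʳ (*-congʳ (trans (⟦⟧-cong (≡.sym (nCk+nC[k+1]≡[n+1]C[k+1] (i ℕ.+ m) m)))
               (⟦⟧-homo-+ ((i ℕ.+ m) C m) _)))) ⟩
        scaled + (⟦ (i ℕ.+ m) C m ⟧ + ⟦ (i ℕ.+ m) C suc m ⟧) * ⟦ s′ ⟧ * x ^ i
          ≈⟨ solve 5 (λ r c d s y → r :+ (c :+ d) :* s :* y := (r :+ c :* s :* y) :+ d :* s :* y) refl
               scaled ⟦ (i ℕ.+ m) C m ⟧ ⟦ (i ℕ.+ m) C suc m ⟧ ⟦ s′ ⟧ (x ^ i) ⟩
        (scaled + term n m i) + raised i ∎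
        where
        s  = stirling₁ n (suc (i ℕ.+ m))
        s′ = stirling₁ n (i ℕ.+ m)
        scaled = ⟦ n ⟧ * (⟦ suc (i ℕ.+ m) C suc m ⟧ * ⟦ s ⟧ * x ^ i)

  -- Falling moments and the Stirling expansions.

  -- L((t−x)ₘ tᵏ), where L is the linear functional with L(tᵏ) = μ k.
  fallingMoment : Carrier → (ℕ → Carrier) → ℕ → ℕ → Carrier
  fallingMoment x μ zero    k = μ k
  fallingMoment x μ (suc m) k = fallingMoment x μ m (suc k) - (x + ⟦ m ⟧) * fallingMoment x μ m k

  module _ (x : Carrier) (μ : ℕ → Carrier) where
    private
      F = fallingMoment x μ

    -- The expansion of tⁿ, multiplied by tᵏ. By the definition of `F`, shift plus weight sends
    -- `F m k` to `F m (suc k)`, so each row step uses the induction hypothesis at `suc k`.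
    stirling₂-expansion : ∀ n k → sum≤ n (λ m → genStirling₂-full x n m * F m k) ≈ μ (n ℕ.+ k)
    stirling₂-expansion zero    k = trans (+-identityʳ _) (trans (*-congʳ corner) (*-identityˡ _))
      where open IsTriangular (genStirling₂-triangular x)
    stirling₂-expansion (suc n) k = begin
      sum≤ (suc n) (λ m → genStirling₂-full x (suc n) m * F m k)
        ≈⟨ sum-row-suc n (λ m → F m k) ⟩
      sum≤ n (λ m → genStirling₂-full x n m * (F (suc m) k + (x + ⟦ m ⟧) * F m k))
        ≈⟨ sum≤-cong n (λ m → *-congˡ {genStirling₂-full x n m}
             (solve 2 (λ a b → (a :- b) :+ b := a) refl (F m (suc k)) ((x + ⟦ m ⟧) * F m k))) ⟩
      sum≤ n (λ m → genStirling₂-full x n m * F m (suc k))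
        ≈⟨ stirling₂-expansion n (suc k) ⟩
      μ (n ℕ.+ suc k)
        ≡⟨ ≡.cong μ (ℕₚ.+-suc n k) ⟩
      μ (suc n ℕ.+ k) ∎
      where open IsTriangular (genStirling₂-triangular x)

    -- The expansion of (x-t)(x-t+1)...(x-t+n-1) in powers of -t, multiplied by tᵏ. The new factor
    -- (x+n) - t asks for the induction hypothesis at both `k` and `suc k`; the sign comes with the
    -- latter.
    stirling₁-expansion : ∀ n k →
      sum≤ n (λ l → genStirling₁-full x n l * ((- 1#) ^ l * μ (l ℕ.+ k))) ≈ (- 1#) ^ n * F n k
    stirling₁-expansion zero    k = trans (+-identityʳ _) (trans (*-congʳ corner) (*-identityˡ _))
      where open IsTriangular (genStirling₁-triangular x)
    stirling₁-expansion (suc n) k = begin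
      sum≤ (suc n) (λ l → genStirling₁-full x (suc n) l * ((- 1#) ^ l * μ (l ℕ.+ k)))
        ≈⟨ sum-row-suc n (λ l → (- 1#) ^ l * μ (l ℕ.+ k)) ⟩
      sum≤ n (λ l → A l * ((- 1#) ^ suc l * μ (suc l ℕ.+ k) + (x + ⟦ n ⟧) * ((- 1#) ^ l * μ (l ℕ.+ k))))
        ≈⟨ sum≤-cong n (λ l → trans
             (solve 5 (λ a e u w v → a :* (:- con (+ 1) :* e :* u :+ w :* (e :* v)) :=
                                     :- con (+ 1) :* (a :* (e :* u)) :+ w :* (a :* (e :* v)))
               refl (A l) ((- 1#) ^ l) (μ (suc l ℕ.+ k)) (x + ⟦ n ⟧) (μ (l ℕ.+ k)))
             (+-congʳ (*-congˡ { - 1# } (*-congˡ {A l} (*-congˡ {(- 1#) ^ l}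
               (reflexive (≡.cong μ (≡.sym (ℕₚ.+-suc l k))))))))) ⟩
      sum≤ n (λ l → - 1# * raised l + (x + ⟦ n ⟧) * kept l)
        ≈⟨ sum≤-linear n (- 1#) (x + ⟦ n ⟧) raised kept ⟩
      - 1# * sum≤ n raised + (x + ⟦ n ⟧) * sum≤ n kept
        ≈⟨ +-cong (*-congˡ (stirling₁-expansion n (suc k))) (*-congˡ (stirling₁-expansion n k)) ⟩
      - 1# * ((- 1#) ^ n * F n (suc k)) + (x + ⟦ n ⟧) * ((- 1#) ^ n * F n k)
        ≈⟨ solve 4 (λ e u w v → :- con (+ 1) :* (e :* u) :+ w :* (e :* v) := :- con (+ 1) :* e :* (u :- w :* v))
             refl ((- 1#) ^ n) (F n (suc k)) (x + ⟦ n ⟧) (F n k) ⟩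
      (- 1#) ^ suc n * F (suc n) k ∎
      where
      open IsTriangular (genStirling₁-triangular x)
      A = genStirling₁-full x n

      raised kept : ℕ → Carrier
      raised l = A l * ((- 1#) ^ l * μ (l ℕ.+ suc k))
      kept l   = A l * ((- 1#) ^ l * μ (l ℕ.+ k))

  -- The Bernoulli functional under t ↦ t+1.

  -- L((t+1)ⁿ), if a is the sequence of moments of L.
  binomialTransform : (ℕ → Carrier) → ℕ → Carrier
  binomialTransform a n = leibniz n a (λ _ → 1#)

  binomialTransform₀ : ∀ a → binomialTransform a 0 ≈ a 0
  binomialTransform₀ a = solve 1 (λ a → (con (+ 1) :+ con (+ 0)) :* a :* con (+ 1) :+ con (+ 0) := a) refl (a 0)

  module _ (x : Carrier) (μ : ℕ → Carrier)
    (bernoulli : ∀ n → binomialTransform μ (suc n) ≈ μ (suc n) + ⟦ suc n ⟧ * x ^ n) where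
    private
      F = fallingMoment x μ
      P = binomialTransform

    -- `P (F m) n` is L((t-x)ₘ (t+1)ⁿ): only the power is shifted. The last factor of (t-x)ₘ₊₁ is
    -- rewritten as (t+1) - 1 - (x+m).
    binomialTransform-fallingMoment : ∀ m n →
      P (F (suc m)) n ≈ P (F m) (suc n) - P (F m) n - (x + ⟦ m ⟧) * P (F m) n
    binomialTransform-fallingMoment m n = begin
      P (F (suc m)) n
        ≈⟨ leibniz-cong n
             (λ i → solve 3 (λ a w b → a :- w :* b := con (+ 1) :* a :+ :- w :* b) refl (F m (suc i)) (x + ⟦ m ⟧) (F m i))
             (λ _ → refl {1#}) ⟩
      leibniz n (λ i → 1# * F m (suc i) + - (x + ⟦ m ⟧) * F m i) (λ _ → 1#)
        ≈⟨ leibniz-linearˡ n 1# (- (x + ⟦ m ⟧)) (λ i → F m (suc i)) (F m) (λ _ → 1#) ⟩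
      1# * S + - (x + ⟦ m ⟧) * P (F m) n
        ≈⟨ solve 3 (λ s w p → con (+ 1) :* s :+ :- w :* p := (s :+ p) :- p :- w :* p) refl S (x + ⟦ m ⟧) (P (F m) n) ⟩
      (S + P (F m) n) - P (F m) n - (x + ⟦ m ⟧) * P (F m) n
        ≈⟨ +-congʳ (+-congʳ (leibniz-suc n (F m) (λ _ → 1#))) ⟨
      P (F m) (suc n) - P (F m) n - (x + ⟦ m ⟧) * P (F m) n ∎
      where S = leibniz n (λ i → F m (suc i)) (λ _ → 1#)

    -- L(p(t+1)) = L(p(t)) + p′(x) for p = (t−x)ₘ₊₁ tⁿ, with (t+1−x)ₘ₊₁ expanded as
    -- (t−x)ₘ₊₁ + (m+1) (t−x)ₘ.
    difference≈derivative : ∀ m n →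
      P (F (suc m)) n + ⟦ suc m ⟧ * P (F m) n ≈ F (suc m) n + (- 1#) ^ m * ⟦ m ! ⟧ * x ^ n
    -- `bernoulli` speaks of positive indices only, so `P μ 0` is computed directly in this case.
    difference≈derivative zero zero = begin
      P (F 1) 0 + ⟦ 1 ⟧ * P μ 0
        ≈⟨ +-congʳ (binomialTransform-fallingMoment 0 0) ⟩
      (P μ 1 - P μ 0 - (x + ⟦ 0 ⟧) * P μ 0) + ⟦ 1 ⟧ * P μ 0
        ≈⟨ solve 3 (λ x p q → (q :- p :- (x :+ con (+ 0)) :* p) :+ (con (+ 1) :+ con (+ 0)) :* p := q :- x :* p)
             refl x (P μ 0) (P μ 1) ⟩
      P μ 1 - x * P μ 0
        ≈⟨ +-cong (bernoulli 0) (-‿cong (*-congˡ (binomialTransform₀ μ))) ⟩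
      (μ 1 + ⟦ 1 ⟧ * 1#) - x * μ 0
        ≈⟨ solve 4 (λ x a b k → (b :+ k :* con (+ 1)) :- x :* a :=
                                (b :- (x :+ con (+ 0)) :* a) :+ con (+ 1) :* k :* con (+ 1))
             refl x (μ 0) (μ 1) ⟦ 1 ⟧ ⟩
      F 1 0 + 1# * ⟦ 1 ⟧ * 1# ∎
    difference≈derivative zero (suc n) = begin
      P (F 1) (suc n) + ⟦ 1 ⟧ * P μ (suc n)
        ≈⟨ +-congʳ (binomialTransform-fallingMoment 0 (suc n)) ⟩
      (P μ (suc (suc n)) - P μ (suc n) - (x + ⟦ 0 ⟧) * P μ (suc n)) + ⟦ 1 ⟧ * P μ (suc n)
        ≈⟨ solve 3 (λ x p q → (q :- p :- (x :+ con (+ 0)) :* p) :+ (con (+ 1) :+ con (+ 0)) :* p := q :- x :* p)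
             refl x (P μ (suc n)) (P μ (suc (suc n))) ⟩
      P μ (suc (suc n)) - x * P μ (suc n)
        ≈⟨ +-cong (bernoulli (suc n)) (-‿cong (*-congˡ (bernoulli n))) ⟩
      (μ (suc (suc n)) + (1# + ⟦ suc n ⟧) * (x * x ^ n)) - x * (μ (suc n) + ⟦ suc n ⟧ * x ^ n)
        ≈⟨ solve 5 (λ x a b k y → (b :+ (con (+ 1) :+ k) :* (x :* y)) :- x :* (a :+ k :* y) :=
                                  (b :- (x :+ con (+ 0)) :* a) :+ con (+ 1) :* (con (+ 1) :+ con (+ 0)) :* (x :* y))
             refl x (μ (suc n)) (μ (suc (suc n))) ⟦ suc n ⟧ (x ^ n) ⟩
      F 1 (suc n) + 1# * ⟦ 1 ⟧ * x ^ suc n ∎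
    difference≈derivative (suc m) n = begin
      P (F (suc (suc m))) n + (1# + k) * p
        ≈⟨ +-congʳ (binomialTransform-fallingMoment (suc m) n) ⟩
      (p′ - p - (x + k) * p) + (1# + k) * p
        ≈⟨ solve 4 (λ x k p p′ → (p′ :- p :- (x :+ k) :* p) :+ (con (+ 1) :+ k) :* p :=
                                  (p′ :- (x :+ k) :* p) :+ k :* p)
             refl x k p p′ ⟩
      (p′ - (x + k) * p) + k * p
        ≈⟨ +-congˡ (*-congˡ (binomialTransform-fallingMoment m n)) ⟩
      (p′ - (x + k) * p) + k * (q′ - q - (x + ⟦ m ⟧) * q)
        -- Because 1 + (x+m) = x + (m+1), the terms regroup into the induction hypothesis at `suc n`
        -- minus `x + k` times the one at `n`, which is also the recurrence of `F`.
        ≈⟨ solve 6 (λ x j p p′ q q′ →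
             (p′ :- (x :+ (con (+ 1) :+ j)) :* p) :+ (con (+ 1) :+ j) :* (q′ :- q :- (x :+ j) :* q) :=
             (p′ :+ (con (+ 1) :+ j) :* q′) :- (x :+ (con (+ 1) :+ j)) :* (p :+ (con (+ 1) :+ j) :* q))
             refl x ⟦ m ⟧ p p′ q q′ ⟩
      (p′ + k * q′) - (x + k) * (p + k * q)
        ≈⟨ +-cong (difference≈derivative m (suc n)) (-‿cong (*-congˡ (difference≈derivative m n))) ⟩
      (F (suc m) (suc n) + e * ⟦ m ! ⟧ * (x * x ^ n)) - (x + k) * (F (suc m) n + e * ⟦ m ! ⟧ * x ^ n)
        ≈⟨ solve 7 (λ x k e f y a b →
             (b :+ e :* f :* (x :* y)) :- (x :+ k) :* (a :+ e :* f :* y) :=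
             (b :- (x :+ k) :* a) :+ :- con (+ 1) :* e :* (k :* f) :* y)
             refl x k e ⟦ m ! ⟧ (x ^ n) (F (suc m) n) (F (suc m) (suc n)) ⟩
      F (suc (suc m)) n + - 1# * e * (k * ⟦ m ! ⟧) * x ^ n
        ≈⟨ +-congˡ (*-congʳ (*-congˡ (⟦⟧-homo-* (suc m) (m !)))) ⟨
      F (suc (suc m)) n + (- 1#) ^ suc m * ⟦ suc m ! ⟧ * x ^ n ∎
      where
      k = ⟦ suc m ⟧
      e = (- 1#) ^ m
      p = P (F (suc m)) n
      p′ = P (F (suc m)) (suc n)
      q = P (F m) n
      q′ = P (F m) (suc n)

    -- At exponent 0 the binomial transform changes nothing, so `F (suc m) 0` stands on both sides
    -- of `difference≈derivative` and cancels.
    suc-*-fallingMoment : ∀ m → ⟦ suc m ⟧ * F m 0 ≈ (- 1#) ^ m * ⟦ m ! ⟧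
    suc-*-fallingMoment m = begin
      ⟦ suc m ⟧ * F m 0
        ≈⟨ solve 2 (λ a b → a := (b :+ a) :- b) refl _ (F (suc m) 0) ⟩
      (F (suc m) 0 + ⟦ suc m ⟧ * F m 0) - F (suc m) 0
        ≈⟨ +-congʳ (+-cong (binomialTransform₀ (F (suc m))) (*-congˡ (binomialTransform₀ (F m)))) ⟨
      (P (F (suc m)) 0 + ⟦ suc m ⟧ * P (F m) 0) - F (suc m) 0
        ≈⟨ +-congʳ (difference≈derivative m 0) ⟩
      (F (suc m) 0 + (- 1#) ^ m * ⟦ m ! ⟧ * 1#) - F (suc m) 0
        ≈⟨ solve 2 (λ a b → (b :+ a :* con (+ 1)) :- b := a) refl _ (F (suc m) 0) ⟩
      (- 1#) ^ m * ⟦ m ! ⟧ ∎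

  -- Reciprocals, and Bernoulli's recurrence from the power series.

  abstract
    ⟦⟧⁻¹ : ∀ n .{{_ : ℕ.NonZero n}} → Carrier
    ⟦⟧⁻¹ n = proj₁ (#⇒invertible (⟦⟧#0 n))

    ⟦⟧⁻¹-inverseˡ : ∀ n .{{_ : ℕ.NonZero n}} → ⟦⟧⁻¹ n * ⟦ n ⟧ ≈ 1#
    -- Invertibility is stated for the difference of two elements that are apart, hence `a - 0#`.
    ⟦⟧⁻¹-inverseˡ n = trans (*-congˡ (solve 1 (λ a → a := a :- con (+ 0)) refl ⟦ n ⟧))
      (proj₁ (proj₂ (#⇒invertible (⟦⟧#0 n))))

    1/!-inverseˡ : ∀ n → 1/ n ! * ⟦ n ! ⟧ ≈ 1#
    1/!-inverseˡ n = ⟦⟧⁻¹-inverseˡ (n !) {{ℕₚ._!≢0 n}}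

  ⟦nCk⟧ : ∀ {n k} → k ℕ.≤ n → ⟦ n ! ⟧ * (1/ k ! * 1/ (n ∸ k) !) ≈ ⟦ n C k ⟧
  ⟦nCk⟧ {n} {k} k≤n = begin
    ⟦ n ! ⟧ * (1/ k ! * 1/ (n ∸ k) !)
      ≈⟨ *-congʳ (trans (⟦⟧-cong n!≡) (trans (⟦⟧-homo-* (n C k) _) (*-congˡ (⟦⟧-homo-* (k !) ((n ∸ k) !))))) ⟩
    ⟦ n C k ⟧ * (⟦ k ! ⟧ * ⟦ (n ∸ k) ! ⟧) * (1/ k ! * 1/ (n ∸ k) !)
      ≈⟨ solve 5 (λ c a b a′ b′ → c :* (a :* b) :* (a′ :* b′) := c :* ((a′ :* a) :* (b′ :* b))) refl _ _ _ _ _ ⟩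
    ⟦ n C k ⟧ * ((1/ k ! * ⟦ k ! ⟧) * (1/ (n ∸ k) ! * ⟦ (n ∸ k) ! ⟧))
      ≈⟨ *-congˡ (*-cong (1/!-inverseˡ k) (1/!-inverseˡ (n ∸ k))) ⟩
    ⟦ n C k ⟧ * (1# * 1#)
      ≈⟨ solve 1 (λ c → c :* (con (+ 1) :* con (+ 1)) := c) refl _ ⟩
    ⟦ n C k ⟧ ∎
    where
    instance _ = k ℕₚ.!* (n ∸ k) !≢0

    n!≡ : n ! ≡ (n C k) ℕ.* (k ! ℕ.* (n ∸ k) !)
    n!≡ = ≡.trans (≡.sym (ℕ.m/n*n≡m (k![n∸k]!∣n! k≤n)))
                  (≡.cong (ℕ._* (k ! ℕ.* (n ∸ k) !)) (≡.sym (nCk≡n!/k![n-k]! k≤n)))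

  1^n≈1 : ∀ n → 1# ^ n ≈ 1#
  1^n≈1 zero    = refl
  1^n≈1 (suc n) = trans (*-identityˡ _) (1^n≈1 n)

  sum≤-oneˢ : ∀ n (f : ℕ → Carrier) → sum≤ n (λ k → oneˢ k * f k) ≈ f 0
  sum≤-oneˢ n f = trans
    (sum≤-truncate {0} {n} {λ k → oneˢ k * f k} ℕ.z≤n (λ { (suc i) _ _ → zeroˡ (f (suc i)) }))
    (trans (+-identityʳ _) (*-identityˡ (f 0)))

  -- The coefficient of t^N in the defining identity, multiplied by N!. Writing e^t as 1 + (e^t -
  -- 1), the summand 1 contributes `B N x` and the rest is the product that `isBernoulli` evaluates.
  bernoulli-recurrence : ∀ {B} → IsBernoulli B → ∀ x n →
    binomialTransform (λ k → B k x) (suc n) ≈ B (suc n) x + ⟦ suc n ⟧ * x ^ n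
  bernoulli-recurrence {B} isBernoulli x n = begin
    binomialTransform (λ k → B k x) N
      ≈⟨ sum≤-cong-≤ N term ⟩
    sum≤ N (λ k → oneˢ k * (⟦ N ! ⟧ * β (N ∸ k)) + ⟦ N ! ⟧ * ((exp 1# k - oneˢ k) * β (N ∸ k)))
      ≈⟨ sum≤-+ N (λ k → oneˢ k * (⟦ N ! ⟧ * β (N ∸ k))) (λ k → ⟦ N ! ⟧ * ((exp 1# k - oneˢ k) * β (N ∸ k))) ⟩
    sum≤ N (λ k → oneˢ k * (⟦ N ! ⟧ * β (N ∸ k))) + sum≤ N (λ k → ⟦ N ! ⟧ * ((exp 1# k - oneˢ k) * β (N ∸ k)))
      ≈⟨ +-cong (sum≤-oneˢ N (λ k → ⟦ N ! ⟧ * β (N ∸ k)))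
                (sym (*-distribˡ-sum≤ N ⟦ N ! ⟧ (λ k → (exp 1# k - oneˢ k) * β (N ∸ k)))) ⟩
    ⟦ N ! ⟧ * β N + ⟦ N ! ⟧ * ((λ k → exp 1# k - oneˢ k) ⊛ β) N
      ≈⟨ +-cong (trans (*-comm _ _) (trans (*-assoc _ _ _) (trans (*-congˡ (1/!-inverseˡ N)) (*-identityʳ _))))
                (*-congˡ (trans (isBernoulli x N) rhs)) ⟩
    B N x + ⟦ N ! ⟧ * (x ^ n * 1/ n !)
      ≈⟨ +-congˡ (trans (*-congʳ (⟦⟧-homo-* N (n !)))
           (trans (solve 4 (λ k f f′ y → k :* f :* (y :* f′) := k :* y :* (f′ :* f)) refl
                     ⟦ N ⟧ ⟦ n ! ⟧ (1/ n !) (x ^ n))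
             (trans (*-congˡ (1/!-inverseˡ n)) (*-identityʳ _)))) ⟩
    B N x + ⟦ N ⟧ * x ^ n ∎
    where
    N = suc n

    β : PowerSeries
    β = egf (λ k → B k x)

    term : ∀ k → k ℕ.≤ N → ⟦ N C k ⟧ * B (N ∸ k) x * 1# ≈
      oneˢ k * (⟦ N ! ⟧ * β (N ∸ k)) + ⟦ N ! ⟧ * ((exp 1# k - oneˢ k) * β (N ∸ k))
    term k k≤N = begin
      ⟦ N C k ⟧ * B (N ∸ k) x * 1#
        ≈⟨ *-cong (*-congʳ (⟦nCk⟧ k≤N)) (1^n≈1 k) ⟨
      ⟦ N ! ⟧ * (1/ k ! * 1/ (N ∸ k) !) * B (N ∸ k) x * 1# ^ k
        ≈⟨ solve 6 (λ f a b β y o → f :* (a :* b) :* β :* y :=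
                                     o :* (f :* (β :* b)) :+ f :* ((y :* a :- o) :* (β :* b)))
             refl ⟦ N ! ⟧ (1/ k !) (1/ (N ∸ k) !) (B (N ∸ k) x) (1# ^ k) (oneˢ k) ⟩
      oneˢ k * (⟦ N ! ⟧ * β (N ∸ k)) + ⟦ N ! ⟧ * ((exp 1# k - oneˢ k) * β (N ∸ k)) ∎

    rhs : (t ⊛ exp x) N ≈ x ^ n * 1/ n !
    rhs = trans (+-cong (zeroˡ _) (sum≤-oneˢ n (λ k → exp x (n ∸ k)))) (+-identityˡ _)

-- Bounds for power sums of naturals.

powerSum : ℕ → ℕ → ℕ
powerSum m zero    = 0
powerSum m (suc n) = powerSum m n ℕ.+ n ℕ.^ m

module _ where
  open ℕₚ.≤-Reasoning

  -- Together with `pow-increment-upper` this confines (i+1)^(m+1) - i^(m+1) between (m+1) i^m and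
  -- (m+1) (i+1)^m, a discrete mean value theorem. Telescoping then bounds the power sums.
  pow-increment-lower : ∀ m i → i ℕ.^ suc m ℕ.+ suc m ℕ.* i ℕ.^ m ℕ.≤ suc i ℕ.^ suc m
  pow-increment-lower zero    i = ℕₚ.≤-reflexive (lemma i)
    where
    lemma : ∀ i → i ℕ.* 1 ℕ.+ 1 ≡ suc i ℕ.* 1
    lemma = solve-∀
  pow-increment-lower (suc m) i = begin
    i ℕ.* a ℕ.+ suc (suc m) ℕ.* a
      ≤⟨ ℕₚ.m≤m+n _ (suc m ℕ.* b) ⟩
    (i ℕ.* (i ℕ.* b) ℕ.+ suc (suc m) ℕ.* (i ℕ.* b)) ℕ.+ suc m ℕ.* b
      ≡⟨ lemma i m b ⟩
    suc i ℕ.* (a ℕ.+ suc m ℕ.* b)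
      ≤⟨ ℕₚ.*-monoʳ-≤ (suc i) (pow-increment-lower m i) ⟩
    suc i ℕ.* suc i ℕ.^ suc m ∎
    where
    a = i ℕ.^ suc m
    b = i ℕ.^ m
    lemma : ∀ i m b → (i ℕ.* (i ℕ.* b) ℕ.+ suc (suc m) ℕ.* (i ℕ.* b)) ℕ.+ suc m ℕ.* b ≡
                      suc i ℕ.* (i ℕ.* b ℕ.+ suc m ℕ.* b)
    lemma = solve-∀

  pow-increment-upper : ∀ m i → suc i ℕ.^ suc m ℕ.≤ i ℕ.^ suc m ℕ.+ suc m ℕ.* suc i ℕ.^ m
  pow-increment-upper zero    i = ℕₚ.≤-reflexive (lemma i)
    where
    lemma : ∀ i → suc i ℕ.* 1 ≡ i ℕ.* 1 ℕ.+ 1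
    lemma = solve-∀
  pow-increment-upper (suc m) i = begin
    suc i ℕ.* a
      ≤⟨ ℕₚ.+-monoʳ-≤ a (ℕₚ.*-monoʳ-≤ i (pow-increment-upper m i)) ⟩
    suc i ℕ.* b ℕ.+ i ℕ.* (i ℕ.^ suc m ℕ.+ suc m ℕ.* b)
      ≤⟨ ℕₚ.m≤m+n _ (suc m ℕ.* b) ⟩
    suc i ℕ.* b ℕ.+ i ℕ.* (i ℕ.^ suc m ℕ.+ suc m ℕ.* b) ℕ.+ suc m ℕ.* b
      ≡⟨ lemma i m b (i ℕ.^ suc m) ⟩
    i ℕ.* i ℕ.^ suc m ℕ.+ suc (suc m) ℕ.* (suc i ℕ.* b) ∎
    where
    a = suc i ℕ.^ suc m
    b = suc i ℕ.^ m
    lemma : ∀ i m b c → suc i ℕ.* b ℕ.+ i ℕ.* (c ℕ.+ suc m ℕ.* b) ℕ.+ suc m ℕ.* b ≡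
                        i ℕ.* c ℕ.+ suc (suc m) ℕ.* (suc i ℕ.* b)
    lemma = solve-∀

  powerSum-upper : ∀ m n → suc m ℕ.* powerSum m n ℕ.≤ n ℕ.^ suc m
  powerSum-upper m zero    = ℕₚ.≤-reflexive (ℕₚ.*-zeroʳ m)
  powerSum-upper m (suc n) = begin
    suc m ℕ.* (powerSum m n ℕ.+ n ℕ.^ m)
      ≡⟨ ℕₚ.*-distribˡ-+ (suc m) (powerSum m n) _ ⟩
    suc m ℕ.* powerSum m n ℕ.+ suc m ℕ.* n ℕ.^ m
      ≤⟨ ℕₚ.+-monoˡ-≤ _ (powerSum-upper m n) ⟩
    n ℕ.^ suc m ℕ.+ suc m ℕ.* n ℕ.^ m
      ≤⟨ pow-increment-lower m n ⟩
    suc n ℕ.^ suc m ∎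

  -- Telescoping starts at 1 rather than 0: for `m > 0` both sides would be 0 at 0, and the
  -- strictness that the base case provides is passed on by every later step.
  powerSum-lower : ∀ m n → suc n ℕ.^ suc m ℕ.< suc m ℕ.* (powerSum m (suc n) ℕ.+ suc n ℕ.^ m)
  powerSum-lower zero    zero    = ℕ.s≤s (ℕ.s≤s ℕ.z≤n)
  powerSum-lower (suc m) zero    rewrite ℕₚ.^-zeroˡ m = ℕ.s≤s (ℕ.s≤s ℕ.z≤n)
  powerSum-lower m       (suc n) = begin-strict
    suc (suc n) ℕ.^ suc m
      ≤⟨ pow-increment-upper m (suc n) ⟩
    suc n ℕ.^ suc m ℕ.+ suc m ℕ.* suc (suc n) ℕ.^ m
      <⟨ ℕₚ.+-monoˡ-< _ (powerSum-lower m n) ⟩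
    suc m ℕ.* (powerSum m (suc n) ℕ.+ suc n ℕ.^ m) ℕ.+ suc m ℕ.* suc (suc n) ℕ.^ m
      ≡⟨ ℕₚ.*-distribˡ-+ (suc m) (powerSum m (suc n) ℕ.+ suc n ℕ.^ m) _ ⟨
    suc m ℕ.* (powerSum m (suc (suc n)) ℕ.+ suc (suc n) ℕ.^ m) ∎

module Integration {c ℓ₁ ℓ₂} (ℝ : RealNumbers c ℓ₁ ℓ₂) where
  open RealNumbers ℝ hiding (zero)
  open RealAnalysis ℝ
  open Umbral ℝ
  open IntegerCoefficientSolver commutativeRing
  open SetoidReasoning (CommutativeRing.setoid commutativeRing)
  private module < = IsStrictPartialOrder isStrictPartialOrder
  open Exp (CommutativeRing.commutativeSemiring commutativeRing) using (^-distrib-*; ^-congˡ; ^-homo-*)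

  -- Strict order and small reciprocals.

  <⇒0<- : ∀ {x y} → x < y → 0# < y - x
  <⇒0<- {x} x<y = <.<-respˡ-≈ (-‿inverseʳ x) (+-monoˡ-< (- x) x<y)

  -- Reduces a strict inequality to a ring identity: it suffices to exhibit a positive expression
  -- equal to the difference.
  0<⇒< : ∀ {x y p} → 0# < p → p ≈ y - x → x < y
  0<⇒< {x} {y} {p} 0<p p≈y-x = <.<-respˡ-≈ (+-identityˡ x) (<.<-respʳ-≈
    (trans (+-congʳ p≈y-x) (solve 2 (λ x y → (y :- x) :+ x := y) refl x y)) (+-monoˡ-< x 0<p))

  +-positive : ∀ {x y} → 0# < x → 0# < y → 0# < x + y
  +-positive {x} {y} 0<x 0<y = <.trans 0<y (<.<-respˡ-≈ (+-identityˡ y) (+-monoˡ-< y 0<x))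

  *-monoˡ-< : ∀ {x y z} → 0# < z → x < y → z * x < z * y
  *-monoˡ-< {x} {y} {z} 0<z x<y = 0<⇒< (*-positive 0<z (<⇒0<- x<y))
    (solve 3 (λ x y z → z :* (y :- x) := z :* y :- z :* x) refl x y z)

  ⟦⟧-mono-< : ∀ {m n} → m ℕ.< n → ⟦ m ⟧ < ⟦ n ⟧
  ⟦⟧-mono-< {zero}  {suc n} _           = 0<⟦suc⟧ n
  ⟦⟧-mono-< {suc m} {suc n} (ℕ.s≤s m<n) = 0<⇒< (<⇒0<- (⟦⟧-mono-< m<n))
    (solve 2 (λ x y → y :- x := (con (+ 1) :+ y) :- (con (+ 1) :+ x)) refl ⟦ m ⟧ ⟦ n ⟧)

  -- Invertibility makes `y` apart from 0, which is what permits a case distinction on its sign. A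
  -- negative `y` would make the positive element `x * (0# - y) + 1#` equal to 0.
  inverse-positive : ∀ {x y} → 0# < x → y * x ≈ 1# → 0# < y
  inverse-positive {x} {y} 0<x yx≈1 with #⇒<⊎> {0#} {y} (#-sym (invertible⇒# (x , x[y-0]≈1 , [y-0]x≈1)))
    where
    [y-0]x≈1 : (y - 0#) * x ≈ 1#
    [y-0]x≈1 = trans (solve 2 (λ x y → (y :- con (+ 0)) :* x := y :* x) refl x y) yx≈1

    x[y-0]≈1 : x * (y - 0#) ≈ 1#
    x[y-0]≈1 = trans (*-comm x (y - 0#)) [y-0]x≈1
  ... | inj₁ 0<y = 0<y
  ... | inj₂ y<0 = ⊥-elim (<.irrefl x[-y]+1≈0 (+-positive (*-positive 0<x (<⇒0<- y<0)) 0<1))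
    where
    x[-y]+1≈0 : 0# ≈ x * (0# - y) + 1#
    x[-y]+1≈0 = trans (solve 2 (λ x y → con (+ 0) := x :* (con (+ 0) :- y) :+ y :* x) refl x y) (+-congˡ yx≈1)

  ⟦⟧⁻¹-positive : ∀ n .{{_ : ℕ.NonZero n}} → 0# < ⟦⟧⁻¹ n
  ⟦⟧⁻¹-positive (suc n) = inverse-positive (0<⟦suc⟧ n) (⟦⟧⁻¹-inverseˡ (suc n))

  -- `N` is an Archimedean bound for 1/ε; the inequality 1/ε < k+1 is then multiplied by ε/(k+1).
  ⟦⟧⁻¹-eventually-< : ∀ ε → 0# < ε → ∃[ N ] (∀ k → N ℕ.≤ k → ⟦⟧⁻¹ (suc k) < ε)
  ⟦⟧⁻¹-eventually-< ε 0<ε = N , λ k N≤k →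
    <.<-respˡ-≈ (trans (*-assoc _ _ _)
                  (trans (*-congˡ (trans (*-congʳ ε≈ε-0) (proj₂ (proj₂ inverse)))) (*-identityʳ _)))
      (<.<-respʳ-≈ (trans (solve 3 (λ h e n → h :* e :* n := h :* n :* e) refl _ ε _)
                      (trans (*-congʳ (⟦⟧⁻¹-inverseˡ (suc k))) (*-identityˡ ε)))
        (*-monoˡ-< (*-positive (⟦⟧⁻¹-positive (suc k)) 0<ε)
          (<.trans (proj₂ (archimedean (proj₁ inverse))) (⟦⟧-mono-< (ℕ.s≤s N≤k)))))
    where
    inverse = #⇒invertible (#-sym (<⇒# 0<ε))
    N = proj₁ (archimedean (proj₁ inverse))
    ε≈ε-0 : ε ≈ ε - 0#
    ε≈ε-0 = solve 1 (λ e → e := e :- con (+ 0)) refl ε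

  half : Carrier → Carrier
  half x = x * ⟦⟧⁻¹ 2

  half+half : ∀ x → half x + half x ≈ x
  half+half x = begin
    half x + half x
      ≈⟨ solve 2 (λ x h → x :* h :+ x :* h := x :* (h :* (con (+ 1) :+ (con (+ 1) :+ con (+ 0)))))
           refl x (⟦⟧⁻¹ 2) ⟩
    x * (⟦⟧⁻¹ 2 * ⟦ 2 ⟧)
      ≈⟨ trans (*-congˡ (⟦⟧⁻¹-inverseˡ 2)) (*-identityʳ x) ⟩
    x ∎

  half-positive : ∀ {x} → 0# < x → 0# < half x
  half-positive 0<x = *-positive 0<x (⟦⟧⁻¹-positive 2)

  -- Limits of sequences.

  Within-resp-≈ : ∀ {ε x x′ y y′} → x ≈ x′ → y ≈ y′ → Within ε x y → Within ε x′ y′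
  Within-resp-≈ x≈x′ y≈y′ (x<y+ε , y<x+ε) =
    <.<-respˡ-≈ x≈x′ (<.<-respʳ-≈ (+-congʳ y≈y′) x<y+ε) ,
    <.<-respˡ-≈ y≈y′ (<.<-respʳ-≈ (+-congʳ x≈x′) y<x+ε)

  ConvergesTo-resp-≈ : ∀ {u v L M} → (∀ k → u k ≈ v k) → L ≈ M → u ConvergesTo L → v ConvergesTo M
  ConvergesTo-resp-≈ u≈v L≈M u→L ε 0<ε =
    proj₁ (u→L ε 0<ε) , λ k N≤k → Within-resp-≈ (u≈v k) L≈M (proj₂ (u→L ε 0<ε) k N≤k)

  ConvergesTo-+ : ∀ {u v L M} → u ConvergesTo L → v ConvergesTo M → (λ k → u k + v k) ConvergesTo (L + M)
  ConvergesTo-+ {u} {v} {L} {M} u→L v→M ε 0<ε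
    with u→L (half ε) (half-positive 0<ε) | v→M (half ε) (half-positive 0<ε)
  ... | N , near | N′ , near′ = N ℕ.⊔ N′ , λ k N⊔N′≤k →
    let (u< , <u) = near k (ℕₚ.≤-trans (ℕₚ.m≤m⊔n N N′) N⊔N′≤k)
        (v< , <v) = near′ k (ℕₚ.≤-trans (ℕₚ.m≤n⊔m N N′) N⊔N′≤k)
    in add u< v< , add <u <v
    where
    add : ∀ {a b a′ b′} → a < b + half ε → a′ < b′ + half ε → a + a′ < (b + b′) + ε
    add {a} {b} {a′} {b′} a<b a′<b′ = 0<⇒< (+-positive (<⇒0<- a<b) (<⇒0<- a′<b′))
      (trans (solve 5 (λ a b a′ b′ h → (b :+ h :- a) :+ (b′ :+ h :- a′) := ((b :+ b′) :+ (h :+ h)) :- (a :+ a′))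
               refl a b a′ b′ (half ε))
        (+-congʳ (+-congˡ (half+half ε))))

  ConvergesTo-* : ∀ {u L} a → u ConvergesTo L → (λ k → a * u k) ConvergesTo (a * L)
  ConvergesTo-* {u} {L} a u→L ε 0<ε = proj₁ near , λ k N≤k →
    let (u< , <u) = proj₂ near k N≤k in scale u< <u , scale <u u<
    where
    -- `K` exceeds both `a` and `- a`, so it bounds the modulus of `a` without a decision on its
    -- sign, and `η` is ε/K.
    n₁ = proj₁ (archimedean a)
    n₂ = proj₁ (archimedean (- a))
    K  = suc n₁ ℕ.+ suc n₂
    η  = ε * ⟦⟧⁻¹ K
    near = u→L η (*-positive 0<ε (⟦⟧⁻¹-positive K))

    Kη≈ε : ⟦ K ⟧ * η ≈ ε
    Kη≈ε = trans (solve 3 (λ k e h → k :* (e :* h) := e :* (h :* k)) refl ⟦ K ⟧ ε (⟦⟧⁻¹ K))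
             (trans (*-congˡ (⟦⟧⁻¹-inverseˡ K)) (*-identityʳ ε))

    0<K-a : 0# < ⟦ K ⟧ - a
    0<K-a = <⇒0<- (<.trans (proj₂ (archimedean a)) (⟦⟧-mono-< {n₁} {K} (ℕₚ.m≤m+n (suc n₁) (suc n₂))))

    0<K+a : 0# < ⟦ K ⟧ - - a
    0<K+a = <⇒0<- (<.trans (proj₂ (archimedean (- a))) (⟦⟧-mono-< {n₂} {K} (ℕₚ.m≤n+m (suc n₂) (suc n₁))))

    -- (K + a)(y + η − x) + (K − a)(x + η − y) = 2 (Kη + a y − a x)
    scale : ∀ {x y} → x < y + η → y < x + η → a * x < a * y + ε
    scale {x} {y} x<y+η y<x+η = 0<⇒<
      (half-positive (+-positive (*-positive 0<K+a (<⇒0<- x<y+η)) (*-positive 0<K-a (<⇒0<- y<x+η))))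
      (begin
        half ((⟦ K ⟧ - - a) * (y + η - x) + (⟦ K ⟧ - a) * (x + η - y))
          ≈⟨ solve 6 (λ k a x y e h →
               ((k :- :- a) :* (y :+ e :- x) :+ (k :- a) :* (x :+ e :- y)) :* h :=
               (a :* y :+ k :* e :- a :* x) :* h :+ (a :* y :+ k :* e :- a :* x) :* h)
               refl ⟦ K ⟧ a x y η (⟦⟧⁻¹ 2) ⟩
        half (a * y + ⟦ K ⟧ * η - a * x) + half (a * y + ⟦ K ⟧ * η - a * x)
          ≈⟨ half+half _ ⟩
        a * y + ⟦ K ⟧ * η - a * x
          ≈⟨ +-congʳ (+-congˡ Kη≈ε) ⟩
        a * y + ε - a * x ∎)

  -- Apartness is tight, so it is enough to refute `L # M`. If the limits differed, tolerance half
  -- the gap would make two positive quantities sum to 0.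
  ConvergesTo-unique : ∀ {u L M} → u ConvergesTo L → u ConvergesTo M → L ≈ M
  ConvergesTo-unique {u} {L} {M} u→L u→M = proj₁ (tight L M) λ L#M →
    [ different u→L u→M , different u→M u→L ]′ (#⇒<⊎> L#M)
    where
    different : ∀ {L M} → u ConvergesTo L → u ConvergesTo M → L < M → ⊥
    different {L} {M} u→L u→M L<M
      with u→L (half (M - L)) (half-positive (<⇒0<- L<M)) | u→M (half (M - L)) (half-positive (<⇒0<- L<M))
    ... | N , near | N′ , near′ =
      <.irrefl sum≈0 (+-positive
        (<⇒0<- (proj₁ (near (N ℕ.⊔ N′) (ℕₚ.m≤m⊔n N N′))))
        (<⇒0<- (proj₂ (near′ (N ℕ.⊔ N′) (ℕₚ.m≤n⊔m N N′)))))
      where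
      h = half (M - L)
      w = u (N ℕ.⊔ N′)
      sum≈0 : 0# ≈ (L + h - w) + (w + h - M)
      sum≈0 = begin
        0#
          ≈⟨ solve 2 (λ l m → con (+ 0) := (l :- m) :+ (m :- l)) refl L M ⟩
        (L - M) + (M - L)
          ≈⟨ +-congˡ (half+half (M - L)) ⟨
        (L - M) + (h + h)
          ≈⟨ solve 4 (λ l m h w → (l :- m) :+ (h :+ h) := (l :+ h :- w) :+ (w :+ h :- m)) refl L M h w ⟩
        (L + h - w) + (w + h - M) ∎

  ConvergesTo-from-rate : ∀ {u L} → (∀ k → Within (⟦⟧⁻¹ (suc k)) (u k) L) → u ConvergesTo L
  ConvergesTo-from-rate {u} {L} near ε 0<ε = proj₁ small , λ k N≤k →
    let δ<ε = proj₂ small k N≤k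
    in <.trans (proj₁ (near k)) (widen L δ<ε) , <.trans (proj₂ (near k)) (widen (u k) δ<ε)
    where
    small = ⟦⟧⁻¹-eventually-< ε 0<ε

    widen : ∀ x {δ} → δ < ε → x + δ < x + ε
    widen x {δ} δ<ε = 0<⇒< (<⇒0<- δ<ε) (solve 3 (λ x d e → e :- d := (x :+ e) :- (x :+ d)) refl x δ ε)

  -- Integrals over the unit interval as limits of uniform sums.

  -- The left Riemann sum over [0,1] with `suc k` equal cells.
  uniformSum : (Carrier → Carrier) → ℕ → Carrier
  uniformSum f k = ∑[ i ≤ k ] f (⟦ i ⟧ * ⟦⟧⁻¹ (suc k)) * ⟦⟧⁻¹ (suc k)


  -- A weaker notion than `HasIntegral` on [0,1], since it tests a single sequence of partitions.
  -- Linearity and uniqueness are inherited directly from limits.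
  record HasMean (f : Carrier → Carrier) (L : Carrier) : Set (c ⊔ ℓ₂) where
    constructor mean
    field
      uniformSum-converges : uniformSum f ConvergesTo L


  HasMean-resp-≈ : ∀ {f g L M} → (∀ t → f t ≈ g t) → L ≈ M → HasMean f L → HasMean g M
  HasMean-resp-≈ {f} {g} f≈g L≈M (mean f→L) = mean (ConvergesTo-resp-≈
    (λ k → sum≤-cong k (λ i → *-congʳ {⟦⟧⁻¹ (suc k)} (f≈g (⟦ i ⟧ * ⟦⟧⁻¹ (suc k)))))
    L≈M f→L)

  HasMean-+ : ∀ {f g L M} → HasMean f L → HasMean g M → HasMean (λ t → f t + g t) (L + M)
  HasMean-+ {f} {g} (mean f→L) (mean g→M) = mean (ConvergesTo-resp-≈
    (λ k → let h = ⟦⟧⁻¹ (suc k) in sym (trans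
      (sum≤-cong k (λ i → distribʳ h (f (⟦ i ⟧ * h)) (g (⟦ i ⟧ * h))))
      (sum≤-+ k (λ i → f (⟦ i ⟧ * h) * h) (λ i → g (⟦ i ⟧ * h) * h))))
    refl (ConvergesTo-+ f→L g→M))

  HasMean-* : ∀ {f L} a → HasMean f L → HasMean (λ t → a * f t) (a * L)
  HasMean-* {f} a (mean f→L) = mean (ConvergesTo-resp-≈
    (λ k → let h = ⟦⟧⁻¹ (suc k) in trans
      (*-distribˡ-sum≤ k a (λ i → f (⟦ i ⟧ * h) * h))
      (sum≤-cong k (λ i → sym (*-assoc a (f (⟦ i ⟧ * h)) h))))
    refl (ConvergesTo-* a f→L))

  HasMean-unique : ∀ {f L M} → HasMean f L → HasMean f M → L ≈ M
  HasMean-unique (mean f→L) (mean f→M) = ConvergesTo-unique f→L f→M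

  module _ (k : ℕ) where
    private
      h = ⟦⟧⁻¹ (suc k)

      mesh-point-< : ∀ i → ⟦ i ⟧ * h < ⟦ suc i ⟧ * h
      mesh-point-< i = 0<⇒< (⟦⟧⁻¹-positive (suc k))
        (solve 2 (λ i h → h := (con (+ 1) :+ i) :* h :- i :* h) refl ⟦ i ⟧ h)

    uniformPartition : TaggedPartition 0# 1# (suc k)
    uniformPartition = record
      { point     = λ i → ⟦ toℕ i ⟧ * h
      ; tag       = λ i → ⟦ toℕ i ⟧ * h
      ; first     = zeroˡ h
      ; last      = trans (*-congʳ (⟦⟧-cong (Finₚ.toℕ-fromℕ (suc k))))
                      (trans (*-comm _ _) (⟦⟧⁻¹-inverseˡ (suc k)))
      ; point≤tag = λ i → <.irrefl (*-congʳ (⟦⟧-cong (≡.sym (Finₚ.toℕ-inject₁ i))))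
      ; tag≤point = λ i → <.asym (mesh-point-< (toℕ i))
      }

    open TaggedPartition uniformPartition

    uniformPartition-width : ∀ i → width i ≈ h
    uniformPartition-width i = trans
      (+-congˡ (-‿cong (*-congʳ (⟦⟧-cong (Finₚ.toℕ-inject₁ i)))))
      (solve 2 (λ i h → (con (+ 1) :+ i) :* h :- i :* h := h) refl ⟦ toℕ i ⟧ h)

    uniformPartition-riemannSum : ∀ f → riemannSum f ≈ uniformSum f k
    uniformPartition-riemannSum f = Sum.sum-cong-≋ semiring {suc k}
      (λ i → *-congˡ {f (⟦ toℕ i ⟧ * h)} (uniformPartition-width i))

  -- As soon as 1/(k+1) is below δ, the uniform partition is among those that the integral controls.
  HasIntegral⇒HasMean : ∀ {f I} → HasIntegral f 0# 1# I → HasMean f I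
  HasIntegral⇒HasMean {f} {I} ∫f≈I = mean converges
    where
    converges : uniformSum f ConvergesTo I
    converges ε 0<ε = proj₁ small , λ k N≤k → Within-resp-≈ (uniformPartition-riemannSum k f) refl
      (proj₂ (proj₂ near) (suc k) (uniformPartition k)
        (λ i → <.<-respˡ-≈ (sym (uniformPartition-width k i)) (proj₂ small k N≤k)))
      where
      near  = ∫f≈I ε 0<ε
      small = ⟦⟧⁻¹-eventually-< (proj₁ near) (proj₁ (proj₂ near))

  uniformSum-power : ∀ m n h →
    ∑[ i ≤ n ] (⟦ i ⟧ * h) ^ m * h ≈ ⟦ powerSum m (suc n) ⟧ * (h ^ m * h)
  uniformSum-power m zero    h = trans (+-identityʳ _)
    (trans (*-congʳ (^-distrib-* ⟦ 0 ⟧ h m)) (trans (*-assoc _ _ _) (*-congʳ (sym (⟦⟧-homo-^ 0 m)))))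
  uniformSum-power m (suc n) h = begin
    sum≤ (suc n) (λ i → (⟦ i ⟧ * h) ^ m * h)
      ≈⟨ sum≤-last n (λ i → (⟦ i ⟧ * h) ^ m * h) ⟩
    sum≤ n (λ i → (⟦ i ⟧ * h) ^ m * h) + (⟦ suc n ⟧ * h) ^ m * h
      ≈⟨ +-cong (uniformSum-power m n h) (trans (*-congʳ (^-distrib-* ⟦ suc n ⟧ h m)) (*-assoc _ _ _)) ⟩
    ⟦ powerSum m (suc n) ⟧ * (h ^ m * h) + ⟦ suc n ⟧ ^ m * (h ^ m * h)
      ≈⟨ distribʳ _ _ _ ⟨
    (⟦ powerSum m (suc n) ⟧ + ⟦ suc n ⟧ ^ m) * (h ^ m * h)
      ≈⟨ *-congʳ (trans (⟦⟧-homo-+ (powerSum m (suc n)) _) (+-congˡ (⟦⟧-homo-^ (suc n) m))) ⟨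
    ⟦ powerSum m (suc (suc n)) ⟧ * (h ^ m * h) ∎

  ^-positive : ∀ {x} n → 0# < x → 0# < x ^ n
  ^-positive zero    0<x = 0<1
  ^-positive (suc n) 0<x = *-positive 0<x (^-positive n 0<x)

  -- The power sum bounds, divided by (m+1)(k+1)^(m+1), place the uniform sum within one mesh width
  -- 1/(k+1) of the limit.
  power-mean : ∀ m → HasMean (_^ m) (⟦⟧⁻¹ (suc m))
  power-mean m = mean (ConvergesTo-from-rate λ k →
    Within-resp-≈ (sym (uniformSum-power m k (⟦⟧⁻¹ (suc k)))) refl (bounds k))
    where
    j = ⟦ suc m ⟧
    g = ⟦⟧⁻¹ (suc m)

    bounds : ∀ k → let h = ⟦⟧⁻¹ (suc k) in Within h (⟦ powerSum m (suc k) ⟧ * (h ^ m * h)) g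
    bounds k =
      <.<-respˡ-≈ (gw*j s) (<.<-respʳ-≈ upper≈ (*-monoˡ-< 0<gw (⟦⟧-mono-< upper))) ,
      <.<-respˡ-≈ gw*NNᵐ≈g (<.<-respʳ-≈ lower≈ (*-monoˡ-< 0<gw (⟦⟧-mono-< (powerSum-lower m k))))
      where
      s  = powerSum m (suc k)
      p  = suc k ℕ.^ m
      h  = ⟦⟧⁻¹ (suc k)
      N  = ⟦ suc k ⟧
      w  = h ^ m * h

      -- `g * w` is the scaling factor h^(m+1)/(m+1) that carries the integer inequalities into the
      -- field.
      0<gw : 0# < g * w
      0<gw = *-positive (⟦⟧⁻¹-positive (suc m))
               (*-positive (^-positive m (⟦⟧⁻¹-positive (suc k))) (⟦⟧⁻¹-positive (suc k)))

      -- The added `suc m ℕ.* p` becomes the tolerance `h` after scaling, and makes the bound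
      -- strict.
      upper : suc m ℕ.* s ℕ.< suc k ℕ.* p ℕ.+ suc m ℕ.* p
      upper = ℕₚ.≤-<-trans (powerSum-upper m (suc k))
        (ℕₚ.m<m+n (suc k ℕ.* p) (ℕₚ.*-mono-≤ {1} {suc m} {1} {p} (ℕ.s≤s ℕ.z≤n) (ℕₚ.m^n>0 (suc k) m)))

      pw≈h : ⟦ p ⟧ * w ≈ h
      pw≈h = begin
        ⟦ p ⟧ * (h ^ m * h)  ≈⟨ *-congʳ (⟦⟧-homo-^ (suc k) m) ⟩
        N ^ m * (h ^ m * h)  ≈⟨ *-assoc _ _ _ ⟨
        (N ^ m * h ^ m) * h  ≈⟨ *-congʳ (^-distrib-* N h m) ⟨
        (N * h) ^ m * h      ≈⟨ *-congʳ (^-congˡ m (trans (*-comm N h) (⟦⟧⁻¹-inverseˡ (suc k)))) ⟩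
        1# ^ m * h           ≈⟨ trans (*-congʳ (1^n≈1 m)) (*-identityˡ h) ⟩
        h                    ∎

      gw*j : ∀ q → g * w * ⟦ suc m ℕ.* q ⟧ ≈ ⟦ q ⟧ * w
      gw*j q = begin
        g * w * ⟦ suc m ℕ.* q ⟧
          ≈⟨ *-congˡ (⟦⟧-homo-* (suc m) q) ⟩
        g * w * (j * ⟦ q ⟧)
          ≈⟨ solve 4 (λ g w j q → g :* w :* (j :* q) := (g :* j) :* (q :* w)) refl g w j ⟦ q ⟧ ⟩
        (g * j) * (⟦ q ⟧ * w)
          ≈⟨ trans (*-congʳ (⟦⟧⁻¹-inverseˡ (suc m))) (*-identityˡ _) ⟩
        ⟦ q ⟧ * w ∎

      gw*jp≈h : g * w * ⟦ suc m ℕ.* p ⟧ ≈ h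
      gw*jp≈h = trans (gw*j p) pw≈h

      gw*NNᵐ≈g : g * w * ⟦ suc k ℕ.* p ⟧ ≈ g
      gw*NNᵐ≈g = begin
        g * w * ⟦ suc k ℕ.* p ⟧
          ≈⟨ *-congˡ (⟦⟧-homo-* (suc k) p) ⟩
        g * w * (N * ⟦ p ⟧)
          ≈⟨ solve 4 (λ g w n p → g :* w :* (n :* p) := g :* ((p :* w) :* n)) refl g w N ⟦ p ⟧ ⟩
        g * ((⟦ p ⟧ * w) * N)
          ≈⟨ *-congˡ (trans (*-congʳ pw≈h) (⟦⟧⁻¹-inverseˡ (suc k))) ⟩
        g * 1#
          ≈⟨ *-identityʳ g ⟩
        g ∎

      upper≈ : g * w * ⟦ suc k ℕ.* p ℕ.+ suc m ℕ.* p ⟧ ≈ g + h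
      upper≈ = trans (*-congˡ (⟦⟧-homo-+ (suc k ℕ.* p) (suc m ℕ.* p)))
        (trans (distribˡ _ _ _) (+-cong gw*NNᵐ≈g gw*jp≈h))

      lower≈ : g * w * ⟦ suc m ℕ.* (s ℕ.+ p) ⟧ ≈ ⟦ s ⟧ * w + h
      lower≈ = trans (*-congˡ (trans (⟦⟧-cong (ℕₚ.*-distribˡ-+ (suc m) s p))
                                     (⟦⟧-homo-+ (suc m ℕ.* s) (suc m ℕ.* p))))
        (trans (distribˡ _ _ _) (+-cong (gw*j s) gw*jp≈h))

  -- Cauchy and Bernoulli polynomials as sources of falling moments.

  module _ {x : Carrier} {μ : ℕ → Carrier} {z g : Carrier → Carrier}
    (z≈g-x : ∀ t → z t ≈ g t - x) (moments : ∀ k → HasMean (λ t → g t ^ k) (μ k)) where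

    -- The new factor g - x - m splits into a multiplication by g, which raises `k`, and a scalar
    -- multiple. By linearity the means follow the recurrence of `fallingMoment`.
    fallingFactorial-mean : ∀ m k →
      HasMean (λ t → fallingFactorial (z t) m * g t ^ k) (fallingMoment x μ m k)
    fallingFactorial-mean zero    k = HasMean-resp-≈ (λ t → sym (*-identityˡ _)) refl (moments k)
    fallingFactorial-mean (suc m) k = HasMean-resp-≈
      (λ t → begin
        ff t * (g t * g t ^ k) + - (x + ⟦ m ⟧) * (ff t * g t ^ k)
          ≈⟨ solve 5 (λ f g x m y → f :* (g :* y) :+ :- (x :+ m) :* (f :* y) := f :* ((g :- x) :- m) :* y)
               refl (ff t) (g t) x ⟦ m ⟧ (g t ^ k) ⟩
        ff t * (g t - x - ⟦ m ⟧) * g t ^ k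
          ≈⟨ *-congʳ (*-congˡ (+-congʳ (z≈g-x t))) ⟨
        ff t * (z t - ⟦ m ⟧) * g t ^ k ∎)
      (solve 3 (λ a w b → a :+ :- w :* b := a :- w :* b) refl _ (x + ⟦ m ⟧) _)
      (HasMean-+ (fallingFactorial-mean m (suc k)) (HasMean-* (- (x + ⟦ m ⟧)) (fallingFactorial-mean m k)))
      where
      ff : Carrier → Carrier
      ff t = fallingFactorial (z t) m

    binomial-integral : ∀ n {I} → HasIntegral (λ t → binomial (z t) n) 0# 1# I →
      ⟦ n ! ⟧ * I ≈ fallingMoment x μ n 0
    binomial-integral n ∫≈I = HasMean-unique {λ t → fallingFactorial (z t) n * 1#}
      (HasMean-resp-≈
        (λ t → trans (solve 3 (λ k f h → k :* (f :* h) := f :* (h :* k))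
                       refl ⟦ n ! ⟧ (fallingFactorial (z t) n) (1/ n !))
                     (*-congˡ (1/!-inverseˡ n)))
        refl (HasMean-* ⟦ n ! ⟧ (HasIntegral⇒HasMean ∫≈I)))
      (fallingFactorial-mean n 0)

  ^-neg : ∀ x n → (- x) ^ n ≈ (- 1#) ^ n * x ^ n
  ^-neg x n = trans (^-congˡ n (solve 1 (λ x → :- x := :- con (+ 1) :* x) refl x)) (^-distrib-* (- 1#) x n)

  cauchyFirst≈ : ∀ {c₁} → IsCauchyFirstKind c₁ → ∀ y n → c₁ n y ≈ fallingMoment y (λ k → ⟦⟧⁻¹ (suc k)) n 0
  cauchyFirst≈ isCauchy y n with isCauchy n y
  ... | I , ∫≈I , c₁≈ = trans c₁≈ (binomial-integral {z = λ t → t - y} {g = λ t → t}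
    (λ t → refl) power-mean n ∫≈I)

  cauchySecond≈ : ∀ {c₂} → IsCauchySecondKind c₂ → ∀ y n →
    c₂ n (- y) ≈ fallingMoment y (λ k → (- 1#) ^ k * ⟦⟧⁻¹ (suc k)) n 0
  cauchySecond≈ isCauchy y n with isCauchy n (- y)
  ... | I , ∫≈I , c₂≈ = trans c₂≈ (binomial-integral {z = λ t → - y - t} {g = -_}
    (λ t → +-comm (- y) (- t))
    (λ k → HasMean-resp-≈ (λ t → sym (^-neg t k)) refl (HasMean-* ((- 1#) ^ k) (power-mean k)))
    n ∫≈I)

  bernoulli-fallingMoment : ∀ {B} → IsBernoulli B → ∀ x m →
    fallingMoment x (λ k → B k x) m 0 ≈ (- 1#) ^ m * ⟦ m ! ⟧ * ⟦⟧⁻¹ (suc m)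
  bernoulli-fallingMoment {B} isBernoulli x m = begin
    F
      ≈⟨ trans (*-congʳ (⟦⟧⁻¹-inverseˡ (suc m))) (*-identityˡ F) ⟨
    ⟦⟧⁻¹ (suc m) * ⟦ suc m ⟧ * F
      ≈⟨ trans (*-assoc _ _ _)
           (*-congˡ (suc-*-fallingMoment x (λ k → B k x) (bernoulli-recurrence isBernoulli x) m)) ⟩
    ⟦⟧⁻¹ (suc m) * ((- 1#) ^ m * ⟦ m ! ⟧)
      ≈⟨ *-comm _ _ ⟩
    (- 1#) ^ m * ⟦ m ! ⟧ * ⟦⟧⁻¹ (suc m) ∎
    where F = fallingMoment x (λ k → B k x) m 0

  genStirling₂-inversion : ∀ y (μ d : ℕ → Carrier) → (∀ l → d l ≈ fallingMoment y μ l 0) → ∀ n →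
    ∑[ l ≤ n ] genStirling₂ n l y * d l ≈ μ n
  genStirling₂-inversion y μ d d≈F n = trans
    (sum≤-cong-≤ n {g = λ l → genStirling₂-full y n l * F l 0}
      (λ l l≤n → *-cong (genStirling₂≈full y l≤n) (d≈F l)))
    (trans (stirling₂-expansion y μ n 0) (reflexive (≡.cong μ (ℕₚ.+-identityʳ n))))
    where F = fallingMoment y μ

  genStirling₁-inversion : ∀ y (μ d : ℕ → Carrier) → (∀ l → d l ≈ fallingMoment y μ l 0) → ∀ n →
    ∑[ l ≤ n ] genStirling₁ n l y * ((- 1#) ^ l * μ l) ≈ (- 1#) ^ n * d n
  genStirling₁-inversion y μ d d≈F n = trans
    (sum≤-cong-≤ n {g = λ l → genStirling₁-full y n l * ((- 1#) ^ l * μ (l ℕ.+ 0))}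
      (λ l l≤n → *-cong (genStirling₁≈full y l≤n)
        (*-congˡ {(- 1#) ^ l} (reflexive (≡.cong μ (≡.sym (ℕₚ.+-identityʳ l)))))))
    (trans (stirling₁-expansion y μ n 0) (*-congˡ (sym (d≈F n))))

  sign²≈1 : ∀ n → (- 1#) ^ n * (- 1#) ^ n ≈ 1#
  sign²≈1 n = trans (sym (^-distrib-* (- 1#) (- 1#) n))
    (trans (^-congˡ n (solve 0 (:- con (+ 1) :* :- con (+ 1) := con (+ 1)) refl)) (1^n≈1 n))

  sign-∸ : ∀ {m n} → m ℕ.≤ n → (- 1#) ^ (n ∸ m) ≈ (- 1#) ^ n * (- 1#) ^ m
  sign-∸ {m} {n} m≤n = begin
    e                                        ≈⟨ trans (*-congˡ (sign²≈1 m)) (*-identityʳ e) ⟨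
    e * ((- 1#) ^ m * (- 1#) ^ m)            ≈⟨ *-assoc _ _ _ ⟨
    e * (- 1#) ^ m * (- 1#) ^ m              ≈⟨ *-congʳ (^-homo-* (- 1#) (n ∸ m) m) ⟨
    (- 1#) ^ (n ∸ m ℕ.+ m) * (- 1#) ^ m      ≈⟨ *-congʳ (reflexive (≡.cong ((- 1#) ^_) (ℕₚ.m∸n+n≡m m≤n))) ⟩
    (- 1#) ^ n * (- 1#) ^ m                  ∎
    where e = (- 1#) ^ (n ∸ m)

  sum≤-factor : ∀ n {f g : ℕ → Carrier} a {s} → (∀ i → i ℕ.≤ n → f i ≈ a * g i) →
    sum≤ n g ≈ s → sum≤ n f ≈ a * s
  sum≤-factor n {f} {g} a f≈ag Σg≈s =
    trans (sum≤-cong-≤ n f≈ag) (trans (sym (*-distribˡ-sum≤ n a g)) (*-congˡ Σg≈s))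

module Identities {c ℓ₁ ℓ₂} (ℝ : RealNumbers c ℓ₁ ℓ₂) where
  open RealNumbers ℝ hiding (zero)
  open RealAnalysis ℝ
  open Umbral ℝ
  open Integration ℝ
  open IntegerCoefficientSolver commutativeRing
  open SetoidReasoning (CommutativeRing.setoid commutativeRing)
  open Exp (CommutativeRing.commutativeSemiring commutativeRing) using (^-homo-*)

  module _ {B c₁ c₂ : ℕ → Carrier → Carrier}
    (isB : IsBernoulli B) (isC₁ : IsCauchyFirstKind c₁) (isC₂ : IsCauchySecondKind c₂)
    (n : ℕ) (x y : Carrier) where

    private
      ε h : ℕ → Carrier
      ε m = (- 1#) ^ m
      h m = ⟦⟧⁻¹ (suc m)

      S₁ S₂ : ℕ → ℕ → Carrier → Carrier
      S₁ = genStirling₁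
      S₂ = genStirling₂

      bernoulli-by-moments : ∑[ m ≤ n ] S₂ n m x * (ε m * ⟦ m ! ⟧ * h m) ≈ B n x
      bernoulli-by-moments = genStirling₂-inversion x (λ k → B k x) (λ m → ε m * ⟦ m ! ⟧ * h m)
        (λ m → sym (bernoulli-fallingMoment isB x m)) n

      bernoulli-moment : ∀ m → ∑[ l ≤ m ] S₁ m l y * (ε l * B l y) ≈ ⟦ m ! ⟧ * h m
      bernoulli-moment m = trans
        (genStirling₁-inversion y (λ k → B k y) (λ m → ε m * ⟦ m ! ⟧ * h m)
          (λ m → sym (bernoulli-fallingMoment isB y m)) m)
        (trans (solve 3 (λ e f h → e :* (e :* f :* h) := (e :* e) :* (f :* h)) refl (ε m) ⟦ m ! ⟧ (h m))
          (trans (*-congʳ (sign²≈1 m)) (*-identityˡ _)))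

    bernoulli-cauchyFirst : B n x ≈
      ∑[ m ≤ n ] ∑[ l ≤ m ] ε m * ⟦ m ! ⟧ * S₂ n m x * S₂ m l y * c₁ l y
    bernoulli-cauchyFirst = sym (trans (sum≤-cong n inner) bernoulli-by-moments)
      where
      inner : ∀ m → ∑[ l ≤ m ] ε m * ⟦ m ! ⟧ * S₂ n m x * S₂ m l y * c₁ l y ≈
        S₂ n m x * (ε m * ⟦ m ! ⟧ * h m)
      inner m = trans
        (sum≤-factor m {g = λ l → S₂ m l y * c₁ l y} (ε m * ⟦ m ! ⟧ * S₂ n m x) (λ l _ → *-assoc _ _ _)
          (genStirling₂-inversion y h (λ l → c₁ l y) (cauchyFirst≈ isC₁ y) m))
        (solve 4 (λ e f s h → e :* f :* s :* h := s :* (e :* f :* h)) refl (ε m) ⟦ m ! ⟧ (S₂ n m x) (h m))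

    bernoulli-cauchySecond : B n x ≈
      ∑[ m ≤ n ] ∑[ l ≤ m ] ⟦ m ! ⟧ * S₂ n m x * S₂ m l y * c₂ l (- y)
    bernoulli-cauchySecond = sym (trans (sum≤-cong n inner) bernoulli-by-moments)
      where
      inner : ∀ m → ∑[ l ≤ m ] ⟦ m ! ⟧ * S₂ n m x * S₂ m l y * c₂ l (- y) ≈
        S₂ n m x * (ε m * ⟦ m ! ⟧ * h m)
      inner m = trans
        (sum≤-factor m {g = λ l → S₂ m l y * c₂ l (- y)} (⟦ m ! ⟧ * S₂ n m x) (λ l _ → *-assoc _ _ _)
          (genStirling₂-inversion y (λ k → ε k * h k) (λ l → c₂ l (- y)) (cauchySecond≈ isC₂ y) m))
        (solve 4 (λ e f s h → f :* s :* (e :* h) := s :* (e :* f :* h)) refl (ε m) ⟦ m ! ⟧ (S₂ n m x) (h m))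

    cauchyFirst-bernoulli : c₁ n x ≈
      ∑[ m ≤ n ] ∑[ l ≤ m ] ε (n ∸ m ℕ.+ l) * 1/ m ! * S₁ n m x * S₁ m l y * B l y
    cauchyFirst-bernoulli = sym (begin
      ∑[ m ≤ n ] ∑[ l ≤ m ] ε (n ∸ m ℕ.+ l) * 1/ m ! * S₁ n m x * S₁ m l y * B l y
        ≈⟨ sum≤-factor n (ε n) inner (genStirling₁-inversion x h (λ m → c₁ m x) (cauchyFirst≈ isC₁ x) n) ⟩
      ε n * (ε n * c₁ n x)
        ≈⟨ trans (sym (*-assoc _ _ _)) (trans (*-congʳ (sign²≈1 n)) (*-identityˡ _)) ⟩
      c₁ n x ∎)
      where
      inner : ∀ m → m ℕ.≤ n → ∑[ l ≤ m ] ε (n ∸ m ℕ.+ l) * 1/ m ! * S₁ n m x * S₁ m l y * B l y ≈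
        ε n * (S₁ n m x * (ε m * h m))
      inner m m≤n = begin
        ∑[ l ≤ m ] ε (n ∸ m ℕ.+ l) * 1/ m ! * S₁ n m x * S₁ m l y * B l y
          ≈⟨ sum≤-factor m {g = λ l → S₁ m l y * (ε l * B l y)} (ε n * ε m * 1/ m ! * S₁ n m x)
               (λ l _ → trans
                 (*-congʳ (*-congʳ (*-congʳ (*-congʳ (trans (^-homo-* (- 1#) (n ∸ m) l) (*-congʳ (sign-∸ m≤n)))))))
                 (solve 7 (λ e e′ d f s s′ b → e :* e′ :* d :* f :* s :* s′ :* b :=
                                               (e :* e′ :* f :* s) :* (s′ :* (d :* b)))
                   refl (ε n) (ε m) (ε l) (1/ m !) (S₁ n m x) (S₁ m l y) (B l y)))
               (bernoulli-moment m) ⟩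
        ε n * ε m * 1/ m ! * S₁ n m x * (⟦ m ! ⟧ * h m)
          ≈⟨ solve 6 (λ e e′ f s k h → e :* e′ :* f :* s :* (k :* h) := (f :* k) :* (e :* (s :* (e′ :* h))))
               refl (ε n) (ε m) (1/ m !) (S₁ n m x) ⟦ m ! ⟧ (h m) ⟩
        (1/ m ! * ⟦ m ! ⟧) * (ε n * (S₁ n m x * (ε m * h m)))
          ≈⟨ trans (*-congʳ (1/!-inverseˡ m)) (*-identityˡ _) ⟩
        ε n * (S₁ n m x * (ε m * h m)) ∎

    cauchySecond-bernoulli : c₂ n (- x) ≈
      ∑[ m ≤ n ] ∑[ l ≤ m ] ε (n ∸ l) * 1/ m ! * S₁ n m x * S₁ m l y * B l y
    cauchySecond-bernoulli = sym (begin
      ∑[ m ≤ n ] ∑[ l ≤ m ] ε (n ∸ l) * 1/ m ! * S₁ n m x * S₁ m l y * B l y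
        ≈⟨ sum≤-factor n (ε n) inner
             (genStirling₁-inversion x (λ k → ε k * h k) (λ m → c₂ m (- x)) (cauchySecond≈ isC₂ x) n) ⟩
      ε n * (ε n * c₂ n (- x))
        ≈⟨ trans (sym (*-assoc _ _ _)) (trans (*-congʳ (sign²≈1 n)) (*-identityˡ _)) ⟩
      c₂ n (- x) ∎)
      where
      inner : ∀ m → m ℕ.≤ n → ∑[ l ≤ m ] ε (n ∸ l) * 1/ m ! * S₁ n m x * S₁ m l y * B l y ≈
        ε n * (S₁ n m x * (ε m * (ε m * h m)))
      inner m m≤n = begin
        ∑[ l ≤ m ] ε (n ∸ l) * 1/ m ! * S₁ n m x * S₁ m l y * B l y
          ≈⟨ sum≤-factor m {g = λ l → S₁ m l y * (ε l * B l y)} (ε n * 1/ m ! * S₁ n m x)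
               (λ l l≤m → trans
                 (*-congʳ (*-congʳ (*-congʳ (*-congʳ (sign-∸ (ℕₚ.≤-trans l≤m m≤n))))))
                 (solve 6 (λ e d f s s′ b → e :* d :* f :* s :* s′ :* b := (e :* f :* s) :* (s′ :* (d :* b)))
                   refl (ε n) (ε l) (1/ m !) (S₁ n m x) (S₁ m l y) (B l y)))
               (bernoulli-moment m) ⟩
        ε n * 1/ m ! * S₁ n m x * (⟦ m ! ⟧ * h m)
          ≈⟨ solve 5 (λ e f s k h → e :* f :* s :* (k :* h) := (f :* k) :* (e :* (s :* h)))
               refl (ε n) (1/ m !) (S₁ n m x) ⟦ m ! ⟧ (h m) ⟩
        (1/ m ! * ⟦ m ! ⟧) * (ε n * (S₁ n m x * h m))
          ≈⟨ trans (*-congʳ (1/!-inverseˡ m)) (*-identityˡ _) ⟩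
        ε n * (S₁ n m x * h m)
          ≈⟨ *-congˡ (*-congˡ (trans (sym (*-assoc _ _ _)) (trans (*-congʳ (sign²≈1 m)) (*-identityˡ _)))) ⟨
        ε n * (S₁ n m x * (ε m * (ε m * h m))) ∎

proposition4 :
  ∀ {c ℓ₁ ℓ₂} (ℝ : RealNumbers c ℓ₁ ℓ₂) →
  let open RealNumbers ℝ
      open RealAnalysis ℝ
  in
  (B c₁ c₂ : ℕ → Carrier → Carrier) →
  IsBernoulli B → IsCauchyFirstKind c₁ → IsCauchySecondKind c₂ →
  ∀ (n : ℕ) (x y : Carrier) →
  (B n x ≈
    ∑[ m ≤ n ] ∑[ l ≤ m ]
      (- 1#) ^ m * ⟦ m ! ⟧ * genStirling₂ n m x * genStirling₂ m l y * c₁ l y)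
  × (B n x ≈
    ∑[ m ≤ n ] ∑[ l ≤ m ]
      ⟦ m ! ⟧ * genStirling₂ n m x * genStirling₂ m l y * c₂ l (- y))
  × (c₁ n x ≈
    ∑[ m ≤ n ] ∑[ l ≤ m ]
      (- 1#) ^ (n ∸ m ℕ.+ l) * 1/ m ! * genStirling₁ n m x * genStirling₁ m l y * B l y)
  × (c₂ n (- x) ≈
    ∑[ m ≤ n ] ∑[ l ≤ m ]
      (- 1#) ^ (n ∸ l) * 1/ m ! * genStirling₁ n m x * genStirling₁ m l y * B l y)
proposition4 ℝ B c₁ c₂ isB isC₁ isC₂ n x y =
  bernoulli-cauchyFirst {B} {c₁} {c₂} isB isC₁ isC₂ n x y ,
  bernoulli-cauchySecond {B} {c₁} {c₂} isB isC₁ isC₂ n x y ,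
  cauchyFirst-bernoulli {B} {c₁} {c₂} isB isC₁ isC₂ n x y ,
  cauchySecond-bernoulli {B} {c₁} {c₂} isB isC₁ isC₂ n x y
  where open Identities ℝ
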